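{- Let $n\ge 2$ and $\alpha\in[0,1]$. If $T$ is a tree of order $n$, then \[ \rho(A_\alpha(T))\le\frac{\alpha n+\sqrt{\alpha^2n^2+4(n-1)(1-2\alpha)}}{2}, \] with equality if and only if $T$ is the star $K_{1,n-1}$.
   Context: For a graph $G$ let $A(G)$ be its adjacency matrix and $D(G)$ the diagonal matrix of its vertex degrees. For $\alpha\in[0,1]$ define $A_\alpha(G)=\alpha D(G)+(1-\alpha)A(G)$. $\rho(M)$ denotes the spectral radius (largest eigenvalue) of a real symmetric nonnegative matrix $M$. -}

module Defs where

open import Algebra.Bundles.Raw using (RawMonoid)
import Algebra.Definitions.RawMonoid as RawMonoidDefs
open import Data.Bool.Base using (Bool; if_then_else_)
import Data.Bool.Properties as Bool
open import Data.Fin.Base using (Fin; toℕ)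
import Data.Fin.Properties as Fin
open import Data.Integer.Base using (+_)
open import Data.List.Base using (List; _∷_; _∷ʳ_; length; filter; allFin)
open import Data.List.Relation.Unary.Linked using (Linked)
open import Data.List.Relation.Unary.Unique.Propositional using (Unique)
open import Data.Nat.Base as ℕ using (ℕ)
import Data.Nat.Properties as ℕ
open import Data.Product.Base using (_×_; _,_; ∃-syntax; Σ-syntax)
open import Data.Rational as ℚ using (ℚ; 0ℚ; ∣_∣)
import Data.Rational.Properties as ℚ
open import Data.Rational.Solver using (module +-*-Solver)
open import Data.Vec.Functional using (Vector)
open import Function.Bundles using (_↔_; _⇔_; Inverse)
open import Level using (0ℓ)
open import Relation.Binary.Construct.Closure.ReflexiveTransitive using (Star)
open import Relation.Binary.Core using (Rel)
open import Relation.Binary.Definitions using (Decidable; Symmetric; Irreflexive)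
open import Relation.Binary.PropositionalEquality
  using (_≡_; _≢_; refl; sym; trans; cong; cong₂; subst; ≢-sym)
open import Relation.Nullary.Decidable.Core using (does; ¬?)
open import Relation.Nullary.Negation.Core using (¬_)

private
  +-dist : ∀ a b c d → ∣ (a ℚ.+ b) ℚ.- (c ℚ.+ d) ∣ ℚ.≤ ∣ a ℚ.- c ∣ ℚ.+ ∣ b ℚ.- d ∣
  +-dist a b c d = subst (λ z → ∣ z ∣ ℚ.≤ ∣ a ℚ.- c ∣ ℚ.+ ∣ b ℚ.- d ∣)
    (solve 4 (λ a b c d → (a :- c) :+ (b :- d) := (a :+ b) :- (c :+ d)) refl a b c d)
    (ℚ.∣p+q∣≤∣p∣+∣q∣ (a ℚ.- c) (b ℚ.- d))
    where open +-*-Solver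

  *-dist : ∀ a b c d →
    ∣ (a ℚ.* b) ℚ.- (c ℚ.* d) ∣ ℚ.≤ ∣ a ∣ ℚ.* ∣ b ℚ.- d ∣ ℚ.+ ∣ d ∣ ℚ.* ∣ a ℚ.- c ∣
  *-dist a b c d = begin
    ∣ (a ℚ.* b) ℚ.- (c ℚ.* d) ∣
      ≡⟨ cong ∣_∣ (solve 4 (λ a b c d →
           (a :* b) :- (c :* d) := a :* (b :- d) :+ d :* (a :- c)) refl a b c d) ⟩
    ∣ a ℚ.* (b ℚ.- d) ℚ.+ d ℚ.* (a ℚ.- c) ∣
      ≤⟨ ℚ.∣p+q∣≤∣p∣+∣q∣ (a ℚ.* (b ℚ.- d)) (d ℚ.* (a ℚ.- c)) ⟩
    ∣ a ℚ.* (b ℚ.- d) ∣ ℚ.+ ∣ d ℚ.* (a ℚ.- c) ∣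
      ≡⟨ cong₂ ℚ._+_ (ℚ.∣p*q∣≡∣p∣*∣q∣ a (b ℚ.- d)) (ℚ.∣p*q∣≡∣p∣*∣q∣ d (a ℚ.- c)) ⟩
    ∣ a ∣ ℚ.* ∣ b ℚ.- d ∣ ℚ.+ ∣ d ∣ ℚ.* ∣ a ℚ.- c ∣ ∎
    where open ℚ.≤-Reasoning
          open +-*-Solver using (solve; _:=_; _:*_; _:+_; _:-_)

  half+half : ∀ ε → ℚ.½ ℚ.* ε ℚ.+ ℚ.½ ℚ.* ε ≡ ε
  half+half ε = trans (sym (ℚ.*-distribʳ-+ ε ℚ.½ ℚ.½)) (ℚ.*-identityˡ ε)

  *-pos : ∀ {p q} → 0ℚ ℚ.< p → 0ℚ ℚ.< q → 0ℚ ℚ.< p ℚ.* q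
  *-pos {p} {q} 0<p 0<q =
    ℚ.positive⁻¹ (p ℚ.* q) {{ℚ.pos*pos⇒pos p {{ℚ.positive 0<p}} q {{ℚ.positive 0<q}}}}

  half-pos : ∀ {ε} → 0ℚ ℚ.< ε → 0ℚ ℚ.< ℚ.½ ℚ.* ε
  half-pos = *-pos (ℚ.positive⁻¹ ℚ.½)

-- Real numbers are Cauchy sequences of rationals with a modulus; equality is _≈_.
Cauchy : (ℕ → ℚ) → Set
Cauchy x = ∀ ε → 0ℚ ℚ.< ε →
  ∃[ N ] (∀ m n → N ℕ.≤ m → N ℕ.≤ n → ∣ x m ℚ.- x n ∣ ℚ.< ε)

record ℝ : Set where
  constructor mkℝ
  field
    seq    : ℕ → ℚ
    cauchy : Cauchy seq

open ℝ public

infix  4 _≈_ _≤_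
infixl 6 _+_ _-_
infixl 7 _*_
infix  8 -_ _²

_≈_ : Rel ℝ 0ℓ
x ≈ y = ∀ ε → 0ℚ ℚ.< ε → ∃[ N ] (∀ n → N ℕ.≤ n → ∣ seq x n ℚ.- seq y n ∣ ℚ.< ε)

_≤_ : Rel ℝ 0ℓ
x ≤ y = ∀ ε → 0ℚ ℚ.< ε → ∃[ N ] (∀ n → N ℕ.≤ n → seq x n ℚ.≤ seq y n ℚ.+ ε)

fromℚ : ℚ → ℝ
fromℚ q = mkℝ (λ _ → q) λ ε 0<ε →
  0 , λ _ _ _ _ → subst (ℚ._< ε) (sym (cong ∣_∣ (ℚ.+-inverseʳ q))) 0<ε

fromℕ : ℕ → ℝ
fromℕ n = fromℚ (+ n ℚ./ 1)

0ℝ 1ℝ ½ : ℝ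
0ℝ = fromℕ 0
1ℝ = fromℕ 1
½  = fromℚ ℚ.½

_+_ : ℝ → ℝ → ℝ
x + y = mkℝ (λ n → seq x n ℚ.+ seq y n) λ ε 0<ε →
  let (M , p) = cauchy x (ℚ.½ ℚ.* ε) (half-pos 0<ε)
      (N , q) = cauchy y (ℚ.½ ℚ.* ε) (half-pos 0<ε)
  in M ℕ.⊔ N , λ m n M⊔N≤m M⊔N≤n →
     ℚ.≤-<-trans (+-dist (seq x m) (seq y m) (seq x n) (seq y n))
       (subst (_ ℚ.<_) (half+half ε)
         (ℚ.+-mono-< (p m n (ℕ.m⊔n≤o⇒m≤o M N M⊔N≤m) (ℕ.m⊔n≤o⇒m≤o M N M⊔N≤n))
                     (q m n (ℕ.m⊔n≤o⇒n≤o M N M⊔N≤m) (ℕ.m⊔n≤o⇒n≤o M N M⊔N≤n))))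

-_ : ℝ → ℝ
- x = mkℝ (λ n → ℚ.- seq x n) λ ε 0<ε →
  let (N , p) = cauchy x ε 0<ε
  in N , λ m n N≤m N≤n → subst (ℚ._< ε)
       (trans (sym (ℚ.∣-p∣≡∣p∣ (seq x m ℚ.- seq x n)))
              (cong ∣_∣ (ℚ.neg-distrib-+ (seq x m) (ℚ.- seq x n))))
       (p m n N≤m N≤n)

_-_ : ℝ → ℝ → ℝ
x - y = x + - y

private
  eventually-bounded : ∀ x →
    ∃[ B ] (0ℚ ℚ.< B × ∃[ N ] (∀ n → N ℕ.≤ n → ∣ seq x n ∣ ℚ.< B))
  eventually-bounded x with cauchy x ℚ.1ℚ (ℚ.positive⁻¹ ℚ.1ℚ)
  ... | N , p = B , ℚ.≤-<-trans (ℚ.0≤∣p∣ (seq x N)) (bound N ℕ.≤-refl) , N , bound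
    where
    B : ℚ
    B = ℚ.1ℚ ℚ.+ ∣ seq x N ∣
    bound : ∀ n → N ℕ.≤ n → ∣ seq x n ∣ ℚ.< B
    bound n N≤n = ℚ.≤-<-trans
      (subst (λ z → ∣ z ∣ ℚ.≤ ∣ seq x n ℚ.- seq x N ∣ ℚ.+ ∣ seq x N ∣)
        (solve 2 (λ a b → (a :- b) :+ b := a) refl (seq x n) (seq x N))
        (ℚ.∣p+q∣≤∣p∣+∣q∣ (seq x n ℚ.- seq x N) (seq x N)))
      (ℚ.+-monoˡ-< ∣ seq x N ∣ (p n N N≤n ℕ.≤-refl))
      where open +-*-Solver

  shrink : ∀ {B ε} → 0ℚ ℚ.< B → 0ℚ ℚ.< ε →
    ∃[ δ ] (0ℚ ℚ.< δ × (∀ {a d} → a ℚ.< B → 0ℚ ℚ.≤ d → d ℚ.< δ → a ℚ.* d ℚ.< ε))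
  shrink {B} {ε} 0<B 0<ε = δ , *-pos 0<1/B 0<ε , small
    where
    instance
      B⁺ : ℚ.Positive B
      B⁺ = ℚ.positive 0<B
      B≠0 : ℚ.NonZero B
      B≠0 = ℚ.pos⇒nonZero B
    0<1/B : 0ℚ ℚ.< ℚ.1/ B
    0<1/B = ℚ.positive⁻¹ (ℚ.1/ B) {{ℚ.1/pos⇒pos B}}
    δ : ℚ
    δ = ℚ.1/ B ℚ.* ε
    small : ∀ {a d} → a ℚ.< B → 0ℚ ℚ.≤ d → d ℚ.< δ → a ℚ.* d ℚ.< ε
    small {a} {d} a<B 0≤d d<δ = begin-strict
      a ℚ.* d             ≤⟨ ℚ.*-monoʳ-≤-nonNeg d {{ℚ.nonNegative 0≤d}} (ℚ.<⇒≤ a<B) ⟩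
      B ℚ.* d             <⟨ ℚ.*-monoʳ-<-pos B d<δ ⟩
      B ℚ.* (ℚ.1/ B ℚ.* ε) ≡⟨ sym (ℚ.*-assoc B (ℚ.1/ B) ε) ⟩
      B ℚ.* ℚ.1/ B ℚ.* ε   ≡⟨ cong (ℚ._* ε) (ℚ.*-inverseʳ B) ⟩
      ℚ.1ℚ ℚ.* ε          ≡⟨ ℚ.*-identityˡ ε ⟩
      ε                   ∎
      where open ℚ.≤-Reasoning

_*_ : ℝ → ℝ → ℝ
x * y = mkℝ (λ n → seq x n ℚ.* seq y n) *-cauchy
  where
  *-cauchy : Cauchy (λ n → seq x n ℚ.* seq y n)
  *-cauchy ε 0<ε =
    let (_ , 0<Bx , N₁ , bx) = eventually-bounded x
        (_ , 0<By , N₂ , by) = eventually-bounded y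
        (δx , 0<δx , sx)     = shrink 0<Bx (half-pos 0<ε)
        (δy , 0<δy , sy)     = shrink 0<By (half-pos 0<ε)
        (N₃ , p)             = cauchy y δx 0<δx
        (N₄ , q)             = cauchy x δy 0<δy
        K₁ = N₁ ℕ.⊔ N₂
        K₂ = N₃ ℕ.⊔ N₄
    in K₁ ℕ.⊔ K₂ , λ m n hm hn →
       ℚ.≤-<-trans (*-dist (seq x m) (seq y m) (seq x n) (seq y n))
         (subst (_ ℚ.<_) (half+half ε) (ℚ.+-mono-<
           (sx (bx m (ℕ.m⊔n≤o⇒m≤o N₁ N₂ (ℕ.m⊔n≤o⇒m≤o K₁ K₂ hm))) (ℚ.0≤∣p∣ _)
               (p m n (ℕ.m⊔n≤o⇒m≤o N₃ N₄ (ℕ.m⊔n≤o⇒n≤o K₁ K₂ hm)) (ℕ.m⊔n≤o⇒m≤o N₃ N₄ (ℕ.m⊔n≤o⇒n≤o K₁ K₂ hn))))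
           (sy (by n (ℕ.m⊔n≤o⇒n≤o N₁ N₂ (ℕ.m⊔n≤o⇒m≤o K₁ K₂ hn))) (ℚ.0≤∣p∣ _)
               (q m n (ℕ.m⊔n≤o⇒n≤o N₃ N₄ (ℕ.m⊔n≤o⇒n≤o K₁ K₂ hm)) (ℕ.m⊔n≤o⇒n≤o N₃ N₄ (ℕ.m⊔n≤o⇒n≤o K₁ K₂ hn))))))

_² : ℝ → ℝ
x ² = x * x

IsSqrt : ℝ → ℝ → Set
IsSqrt s x = 0ℝ ≤ s × s ² ≈ x

+-rawMonoid : RawMonoid 0ℓ 0ℓ
+-rawMonoid = record { Carrier = ℝ ; _≈_ = _≈_ ; _∙_ = _+_ ; ε = 0ℝ }

open RawMonoidDefs +-rawMonoid public using (sum)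

Matrix : ℕ → Set
Matrix n = Fin n → Fin n → ℝ

IsEigenvalue : ∀ {n} → Matrix n → ℝ → Set
IsEigenvalue {n} M μ = Σ[ x ∈ Vector ℝ n ]
  ¬ (∀ i → x i ≈ 0ℝ) × (∀ i → sum (λ j → M i j * x j) ≈ μ * x i)

IsLargestEigenvalue : ∀ {n} → Matrix n → ℝ → Set
IsLargestEigenvalue M ρ = IsEigenvalue M ρ × (∀ μ → IsEigenvalue M μ → μ ≤ ρ)

record Graph (n : ℕ) : Set₁ where
  field
    Adj        : Rel (Fin n) 0ℓ
    adj?       : Decidable Adj
    adj-sym    : Symmetric Adj
    adj-irrefl : Irreflexive _≡_ Adj

open Graph public

degree : ∀ {n} → Graph n → Fin n → ℕ
degree {n} G v = length (filter (adj? G v) (allFin n))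

Connected : ∀ {n} → Graph n → Set
Connected G = ∀ u v → Star (Adj G) u v

-- The distinct vertices v ∷ vs, at least three of them, form a cycle.
IsCycle : ∀ {n} → Graph n → Fin n → List (Fin n) → Set
IsCycle G v vs = 2 ℕ.≤ length vs × Unique (v ∷ vs) × Linked (Adj G) (v ∷ vs ∷ʳ v)

Acyclic : ∀ {n} → Graph n → Set
Acyclic G = ∀ v vs → ¬ IsCycle G v vs

IsTree : ∀ {n} → Graph n → Set
IsTree G = Connected G × Acyclic G

infix 4 _≅_

record _≅_ {m n} (G : Graph m) (H : Graph n) : Set where
  field
    bijection : Fin m ↔ Fin n
    adj⇔adj   : ∀ u v → Adj G u v ⇔ Adj H (Inverse.to bijection u) (Inverse.to bijection v)

-- Complete bipartite graph: the parts are the first p and the last q vertices.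
K : ∀ p q → Graph (p ℕ.+ q)
K p q = record
  { Adj        = λ u v → side u ≢ side v
  ; adj?       = λ u v → ¬? (side u Bool.≟ side v)
  ; adj-sym    = ≢-sym
  ; adj-irrefl = λ u≡v su≢sv → su≢sv (cong side u≡v)
  }
  where
  side : Fin (p ℕ.+ q) → Bool
  side v = toℕ v ℕ.<ᵇ p

adjacencyMatrix : ∀ {n} → Graph n → Matrix n
adjacencyMatrix G u v = if does (adj? G u v) then 1ℝ else 0ℝ

degreeMatrix : ∀ {n} → Graph n → Matrix n
degreeMatrix G u v = if does (u Fin.≟ v) then fromℕ (degree G u) else 0ℝ

A[_] : ∀ {n} → ℝ → Graph n → Matrix n
A[ α ] G u v = α * degreeMatrix G u v + (1ℝ - α) * adjacencyMatrix G u v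

{-# OPTIONS --safe #-}

-- Put B = (αn + s)/2, the larger root of B² = αnB + (n−1)(1−2α), and let S(u) be the sum of the
-- degrees of the neighbours of u. Having no 3- or 4-cycle, a tree satisfies S(u) ≤ n − 1. The
-- weight w(u) = (d(u)−1)(B−1) + (n−2)(1−α), which on a star is proportional to the Perron
-- vector, satisfies
--   B w(u) − (A_α w)(u) = α(B−1)(d(u)−1)(n−1−d(u)) + (1−α)(B−1)(n−1−S(u)) ≥ 0.
-- Pairing this with y = |z| for an eigenvector z of an eigenvalue μ, for which A_α y ≥ μ y, the
-- symmetry of A_α gives μ ≤ B. If μ = B, then y is positive by connectedness, so S(u) = n − 1 for
-- all u: any two vertices are at distance at most 2, and having no 5-cycle, the tree is a star.
-- When B ≥ n − 1 (in particular when α = 1 or n = 2, where w vanishes somewhere) the constant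
-- weight does the same job. Case distinctions on reals are made under ¬¬, which is harmless since
-- ≤ and ≈ are stable and being a star is decidable.
module Submission where

open import Algebra.Bundles using (CommutativeRing)
open import Algebra.Solver.Ring.AlmostCommutativeRing using (fromCommutativeRing; _-Raw-AlmostCommutative⟶_)
open import Data.Bool.Base using (true; false; if_then_else_)
open import Data.Empty using (⊥; ⊥-elim)
open import Data.Fin.Base using (Fin; zero; suc)
open import Data.Fin.Permutation using (transpose; _⟨$⟩ʳ_)
open import Data.Fin.Properties using (_≟_; any?; suc-injective)
open import Data.Integer.Base as ℤ using (+_)
import Data.Integer.Properties as ℤ
open import Data.List.Base using ([]; _∷_; length; filter; tabulate)
open import Data.List.Relation.Unary.All using ([]; _∷_)
open import Data.List.Relation.Unary.AllPairs using ([]; _∷_)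
open import Data.List.Relation.Unary.Linked using ([-]; _∷_)
open import Data.Maybe.Base using (Maybe; just; nothing)
open import Data.Nat.Base as ℕ using (ℕ; zero; suc; s≤s; z≤n)
import Data.Nat.Properties as ℕ
open import Data.Product.Base using (_,_; ∃-syntax; Σ-syntax; proj₁; proj₂)
open import Data.Rational as ℚ using (ℚ; 0ℚ; 1ℚ; ∣_∣)
import Data.Rational.Properties as ℚ
open import Data.Rational.Solver using (module +-*-Solver)
open import Data.Rational.Unnormalised as ℚᵘ using (mkℚᵘ; *≡*)
import Data.Rational.Unnormalised.Properties as ℚᵘ
open import Data.Sum.Base using (_⊎_; inj₁; inj₂; [_,_]′)
open import Function.Base using (_∘_)
open import Function.Bundles using (_↔_; mk⇔; Equivalence; Inverse)
open import Function.Construct.Composition using (_⇔-∘_)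
open import Function.Construct.Symmetry using (⇔-sym)
open import Level using (0ℓ)
open import Relation.Binary.Bundles using (Poset)
open import Relation.Binary.Core using (Rel)
open import Relation.Binary.PropositionalEquality
  using (_≡_; _≢_; refl; sym; trans; cong; cong₂; subst; subst₂; ≢-sym)
open import Relation.Nullary.Decidable
  using (Dec; yes; no; does; _×-dec_; ¬?; dec-true; dec-false; decidable-stable)
open import Relation.Nullary.Negation.Core using (¬_; contradiction)

import Defs
open import Data.Nat using (_∸_; _≥_)
open import Data.Product using (_×_)
open import Function.Bundles using (_⇔_)

-- The bound on `S` counts walks of length 2 from `u`: `d(u)` of them return, and without triangles
-- and 4-cycles the others end at distinct vertices outside the closed neighbourhood of `u`, so
-- `S(u) - d(u) ≤ n - 1 - d(u)`. Weights affine in the degree fit this estimate, since `A_α` turns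
-- them into expressions in `d` and `S` alone. Positivity of `y` is what carries tightness to every
-- vertex: where `y` vanishes, a zero product says nothing about the slack. The other half of the
-- equality case comes from the star itself: a vector with one value at the centre and another at
-- the leaves shows that `B` is an eigenvalue, hence at most `ρ`.

-- Inequalities between rationals

module Rationals where
  open import Data.Rational

  <⇒≱ : ∀ {p q} → p < q → ¬ (q ≤ p)
  <⇒≱ p<q q≤p = ℚ.<-irrefl refl (ℚ.<-≤-trans p<q q≤p)

  translate-≤ : ∀ r {p q p′ q′} → r + p ≡ p′ → r + q ≡ q′ → p ≤ q → p′ ≤ q′
  translate-≤ r refl refl p≤q = ℚ.+-monoʳ-≤ r p≤q

  translate-< : ∀ r {p q p′ q′} → r + p ≡ p′ → r + q ≡ q′ → p < q → p′ < q′
  translate-< r refl refl p<q = ℚ.+-monoʳ-< r p<q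

  *-pos : ∀ {p q} → 0ℚ < p → 0ℚ < q → 0ℚ < p * q
  *-pos {p} {q} 0<p 0<q =
    ℚ.positive⁻¹ (p * q) {{ℚ.pos*pos⇒pos p {{positive 0<p}} q {{positive 0<q}}}}

  half-pos : ∀ {p} → 0ℚ < p → 0ℚ < ½ * p
  half-pos = *-pos (ℚ.positive⁻¹ ½)

  half+half : ∀ p → ½ * p + ½ * p ≡ p
  half+half p = trans (sym (ℚ.*-distribʳ-+ p ½ ½)) (ℚ.*-identityˡ p)

  half< : ∀ {p} → 0ℚ < p → ½ * p < p
  half< {p} 0<p = translate-< (½ * p) (ℚ.+-identityʳ _) (half+half p) (half-pos 0<p)

  p<p+q : ∀ p {q} → 0ℚ < q → p < p + q
  p<p+q p 0<q = translate-< p (ℚ.+-identityʳ p) refl 0<q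

  p≤∣p∣ : ∀ p → p ≤ ∣ p ∣
  p≤∣p∣ p with ℚ.∣p∣≡p∨∣p∣≡-p p
  ... | inj₁ eq = ℚ.≤-reflexive (sym eq)
  ... | inj₂ eq with p ≤? 0ℚ
  ...   | yes p≤0 = ℚ.≤-trans p≤0 (ℚ.0≤∣p∣ p)
  ...   | no  p≰0 = ℚ.≤-reflexive (sym (ℚ.0≤p⇒∣p∣≡p (ℚ.<⇒≤ (ℚ.≰⇒> p≰0))))

  ∣p-q∣<r⇒p≤q+r : ∀ {p q r} → ∣ p - q ∣ < r → p ≤ q + r
  ∣p-q∣<r⇒p≤q+r {p} {q} d<r =
    translate-≤ q (solve 2 (λ p q → q :+ (p :- q) := p) refl p q) refl
      (ℚ.≤-trans (p≤∣p∣ (p - q)) (ℚ.<⇒≤ d<r))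
    where open +-*-Solver

  ∣p-q∣≡∣q-p∣ : ∀ p q → ∣ p - q ∣ ≡ ∣ q - p ∣
  ∣p-q∣≡∣q-p∣ p q = trans (cong ∣_∣ (solve 2 (λ p q → p :- q := :- (q :- p)) refl p q))
                          (ℚ.∣-p∣≡∣p∣ (q - p))
    where open +-*-Solver

  p≤q+r∧q≤p+r⇒∣p-q∣≤r : ∀ {p q r} → p ≤ q + r → q ≤ p + r → ∣ p - q ∣ ≤ r
  p≤q+r∧q≤p+r⇒∣p-q∣≤r {p} {q} {r} h k with ℚ.∣p∣≡p∨∣p∣≡-p (p - q)
  ... | inj₁ eq = subst (_≤ r) (sym eq) (translate-≤ (- q)
          (solve 2 (λ p q → :- q :+ p := p :- q) refl p q)
          (solve 2 (λ q r → :- q :+ (q :+ r) := r) refl q r) h)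
    where open +-*-Solver
  ... | inj₂ eq = subst (_≤ r) (sym eq) (translate-≤ (- p)
          (solve 2 (λ p q → :- p :+ q := :- (p :- q)) refl p q)
          (solve 2 (λ q r → :- q :+ (q :+ r) := r) refl p r) k)
    where open +-*-Solver

  ≤-or-> : ∀ p q → p ≤ q ⊎ q < p
  ≤-or-> p q with p ≤? q
  ... | yes p≤q = inj₁ p≤q
  ... | no  p≰q = inj₂ (ℚ.≰⇒> p≰q)

  -- Cutting at `½ * ε` with drift below `½ * (½ * ε)` leaves room on both sides: below the cut the
  -- difference stays under `ε`, and above it (`near->`) a gap of a quarter of `ε` survives.
  near-≤ : ∀ {ε a b c d} → 0ℚ < ε → ∣ (a - b) - (c - d) ∣ < ½ * (½ * ε) → c - d ≤ ½ * ε → a ≤ b + ε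
  near-≤ {ε} {a} {b} {c} {d} 0<ε close c-d≤ = translate-≤ b
    (solve 2 (λ a b → b :+ (a :- b) := a) refl a b) refl
    (begin
      a - b                       ≤⟨ ∣p-q∣<r⇒p≤q+r close ⟩
      (c - d) + ½ * (½ * ε)       ≤⟨ ℚ.+-mono-≤ c-d≤ (ℚ.<⇒≤ (half< (half-pos 0<ε))) ⟩
      ½ * ε + ½ * ε               ≡⟨ half+half ε ⟩
      ε                           ∎)
    where open ℚ.≤-Reasoning
          open +-*-Solver using (solve; _:=_; _:+_; _:-_)

  near-> : ∀ {ε a b c d} → ∣ (c - d) - (a - b) ∣ < ½ * (½ * ε) → ½ * ε < c - d → b + ½ * (½ * ε) ≤ a
  near-> {ε} {a} {b} {c} {d} close <c-d = translate-≤ (b - η)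
    (trans (cong (λ x → (b - η) + x) (sym (half+half (½ * ε))))
      (solve 2 (λ b e → (b :- e) :+ (e :+ e) := b :+ e) refl b η))
    (solve 3 (λ a b e → (b :- e) :+ ((a :- b) :+ e) := a) refl a b η)
    (ℚ.≤-trans (ℚ.<⇒≤ <c-d) (∣p-q∣<r⇒p≤q+r close))
    where open +-*-Solver using (solve; _:=_; _:+_; _:-_)
          η = ½ * (½ * ε)

  gap : ∀ {δ a b} → 0ℚ < δ → b + δ ≤ a → ¬ (a ≤ b + ½ * δ)
  gap {b = b} 0<δ b+δ≤a a≤ = <⇒≱ (ℚ.+-monoʳ-< b (half< 0<δ)) (ℚ.≤-trans b+δ≤a a≤)

  slack : ∀ {δ ε a b} → 0ℚ < δ → 0ℚ < ε → b + δ ≤ a → b ≤ a + ε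
  slack {a = a} {b} 0<δ 0<ε b+δ≤a =
    ℚ.≤-trans (ℚ.≤-trans (ℚ.<⇒≤ (p<p+q b 0<δ)) b+δ≤a) (ℚ.<⇒≤ (p<p+q a 0<ε))

  -- By contraposition: `η < a` together with `δ ≤ b` would give `η * δ < a * b`.
  *-small : ∀ {δ η a b} → 0ℚ < δ → 0ℚ < η → 0ℚ + δ ≤ b → a * b ≤ 0ℚ + η * δ → a ≤ 0ℚ + η
  *-small {δ} {η} {a} {b} 0<δ 0<η δ≤b ab≤ηδ with ≤-or-> a (0ℚ + η)
  ... | inj₁ a≤η = a≤η
  ... | inj₂ η<a′ = contradiction ab≤ηδ (<⇒≱ (begin-strict
      0ℚ + η * δ     ≡⟨ ℚ.+-identityˡ _ ⟩
      η * δ          <⟨ ℚ.*-monoˡ-<-pos δ {{positive 0<δ}} η<a ⟩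
      a * δ          ≤⟨ ℚ.*-monoˡ-≤-nonNeg a {{nonNegative (ℚ.<⇒≤ (ℚ.<-trans 0<η η<a))}}
                          (subst (_≤ b) (ℚ.+-identityˡ δ) δ≤b) ⟩
      a * b          ∎))
    where
    open ℚ.≤-Reasoning
    η<a : η < a
    η<a = subst (_< a) (ℚ.+-identityˡ η) η<a′

-- Cauchy reals: ring structure and a stable order

module RealNumbers where
  open Rationals
  open import Defs

  Eventually : (ℕ → Set) → Set
  Eventually P = ∃[ N ] (∀ n → N ℕ.≤ n → P n)

  ev-map : ∀ {P Q} → (∀ n → P n → Q n) → Eventually P → Eventually Q
  ev-map f (N , p) = N , λ n N≤n → f n (p n N≤n)

  ev-zip : ∀ {P Q R} → (∀ n → P n → Q n → R n) → Eventually P → Eventually Q → Eventually R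
  ev-zip f (M , p) (N , q) = M ℕ.⊔ N , λ n h →
    f n (p n (ℕ.m⊔n≤o⇒m≤o M N h)) (q n (ℕ.m⊔n≤o⇒n≤o M N h))

  ev-⊥ : ¬ Eventually (λ _ → ⊥)
  ev-⊥ (N , p) = p N ℕ.≤-refl

  pointwise : ∀ {x y} → (∀ n → seq x n ≡ seq y n) → x ≈ y
  pointwise {x} {y} eq ε 0<ε = 0 , λ n _ → subst (ℚ._< ε)
    (sym (cong ∣_∣ (trans (cong (ℚ._- seq y n) (eq n)) (ℚ.+-inverseʳ (seq y n))))) 0<ε

  ≈⇒≤ : ∀ {x y} → x ≈ y → x ≤ y
  ≈⇒≤ x≈y ε 0<ε = ev-map (λ _ → ∣p-q∣<r⇒p≤q+r) (x≈y ε 0<ε)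

  ≈⇒≥ : ∀ {x y} → x ≈ y → y ≤ x
  ≈⇒≥ {x} {y} x≈y ε 0<ε = ev-map
    (λ n d → ∣p-q∣<r⇒p≤q+r (subst (ℚ._< ε) (∣p-q∣≡∣q-p∣ (seq x n) (seq y n)) d)) (x≈y ε 0<ε)

  ≤-antisym : ∀ {x y} → x ≤ y → y ≤ x → x ≈ y
  ≤-antisym x≤y y≤x ε 0<ε = ev-zip
    (λ n h k → ℚ.≤-<-trans (p≤q+r∧q≤p+r⇒∣p-q∣≤r h k) (half< 0<ε))
    (x≤y (ℚ.½ ℚ.* ε) (half-pos 0<ε)) (y≤x (ℚ.½ ℚ.* ε) (half-pos 0<ε))

  +-mono-≤ : ∀ {x y u v} → x ≤ y → u ≤ v → x + u ≤ y + v
  +-mono-≤ {x} {y} {u} {v} x≤y u≤v ε 0<ε = ev-zip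
    (λ n h k → subst (seq x n ℚ.+ seq u n ℚ.≤_) (regroup (seq y n) (seq v n)) (ℚ.+-mono-≤ h k))
    (x≤y (ℚ.½ ℚ.* ε) (half-pos 0<ε)) (u≤v (ℚ.½ ℚ.* ε) (half-pos 0<ε))
    where
    open +-*-Solver
    regroup : ∀ p q → (p ℚ.+ ℚ.½ ℚ.* ε) ℚ.+ (q ℚ.+ ℚ.½ ℚ.* ε) ≡ (p ℚ.+ q) ℚ.+ ε
    regroup p q = trans
      (solve 3 (λ p q e → (p :+ e) :+ (q :+ e) := (p :+ q) :+ (e :+ e)) refl p q (ℚ.½ ℚ.* ε))
      (cong (p ℚ.+ q ℚ.+_) (half+half ε))

  ≤-trans : ∀ {x y z} → x ≤ y → y ≤ z → x ≤ z
  ≤-trans {x} {y} {z} x≤y y≤z ε 0<ε = ev-zip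
    (λ n h k → ℚ.≤-trans h (subst (seq y n ℚ.+ ℚ.½ ℚ.* ε ℚ.≤_) (regroup (seq z n))
      (ℚ.+-monoˡ-≤ (ℚ.½ ℚ.* ε) k)))
    (x≤y (ℚ.½ ℚ.* ε) (half-pos 0<ε)) (y≤z (ℚ.½ ℚ.* ε) (half-pos 0<ε))
    where
    regroup : ∀ p → (p ℚ.+ ℚ.½ ℚ.* ε) ℚ.+ ℚ.½ ℚ.* ε ≡ p ℚ.+ ε
    regroup p = trans (ℚ.+-assoc p _ _) (cong (p ℚ.+_) (half+half ε))

  neg-antimono-≤ : ∀ {x y} → x ≤ y → - y ≤ - x
  neg-antimono-≤ {x} {y} x≤y ε 0<ε = ev-map
    (λ n → translate-≤ (ℚ.- seq x n ℚ.- seq y n)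
      (solve 2 (λ a b → (:- a :- b) :+ a := :- b) refl (seq x n) (seq y n))
      (solve 3 (λ a b e → (:- a :- b) :+ (b :+ e) := :- a :+ e) refl (seq x n) (seq y n) ε))
    (x≤y ε 0<ε)
    where open +-*-Solver

  ≈-refl : ∀ {x} → x ≈ x
  ≈-refl {x} = pointwise {x} {x} (λ _ → refl)

  ≈-sym : ∀ {x y} → x ≈ y → y ≈ x
  ≈-sym {x} {y} x≈y = ≤-antisym {y} {x} (≈⇒≥ {x} {y} x≈y) (≈⇒≤ {x} {y} x≈y)

  ≈-trans : ∀ {x y z} → x ≈ y → y ≈ z → x ≈ z
  ≈-trans {x} {y} {z} x≈y y≈z = ≤-antisym {x} {z}
    (≤-trans {x} {y} {z} (≈⇒≤ {x} {y} x≈y) (≈⇒≤ {y} {z} y≈z))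
    (≤-trans {z} {y} {x} (≈⇒≥ {y} {z} y≈z) (≈⇒≥ {x} {y} x≈y))

  +-cong : ∀ {x y u v} → x ≈ y → u ≈ v → x + u ≈ y + v
  +-cong {x} {y} {u} {v} x≈y u≈v = ≤-antisym {x + u} {y + v}
    (+-mono-≤ {x} {y} {u} {v} (≈⇒≤ {x} {y} x≈y) (≈⇒≤ {u} {v} u≈v))
    (+-mono-≤ {y} {x} {v} {u} (≈⇒≥ {x} {y} x≈y) (≈⇒≥ {u} {v} u≈v))

  neg-cong : ∀ {x y} → x ≈ y → - x ≈ - y
  neg-cong {x} {y} x≈y = ≤-antisym { - x} { - y}
    (neg-antimono-≤ {y} {x} (≈⇒≥ {x} {y} x≈y)) (neg-antimono-≤ {x} {y} (≈⇒≤ {x} {y} x≈y))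

  eventually-bounded : ∀ x → ∃[ B ] (0ℚ ℚ.< B × Eventually (λ n → ∣ seq x n ∣ ℚ.≤ B))
  eventually-bounded x with cauchy x 1ℚ (ℚ.positive⁻¹ 1ℚ)
  ... | N , close = B , ℚ.≤-<-trans (ℚ.0≤∣p∣ (seq x N)) (p<p+q _ (ℚ.positive⁻¹ 1ℚ)) , N , bound
    where
    B = ∣ seq x N ∣ ℚ.+ 1ℚ
    bound : ∀ n → N ℕ.≤ n → ∣ seq x n ∣ ℚ.≤ B
    bound n N≤n = ℚ.≤-trans
      (subst (λ p → ∣ p ∣ ℚ.≤ ∣ seq x N ∣ ℚ.+ ∣ seq x n ℚ.- seq x N ∣)
        (solve 2 (λ p q → p :+ (q :- p) := q) refl (seq x N) (seq x n))
        (ℚ.∣p+q∣≤∣p∣+∣q∣ (seq x N) (seq x n ℚ.- seq x N)))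
      (ℚ.+-monoʳ-≤ ∣ seq x N ∣ (ℚ.<⇒≤ (close n N N≤n ℕ.≤-refl)))
      where open +-*-Solver

  *-near : ∀ {B ε} → 0ℚ ℚ.< B → 0ℚ ℚ.< ε → ∃[ δ ] (0ℚ ℚ.< δ × ∀ {a b c} →
    ∣ a ∣ ℚ.≤ B → ∣ b ℚ.- c ∣ ℚ.< δ → ∣ a ℚ.* b ℚ.- a ℚ.* c ∣ ℚ.< ε)
  *-near {B} {ε} 0<B 0<ε = ℚ.1/ B ℚ.* ε , *-pos 0<1/B 0<ε , close
    where
    instance
      B⁺ : ℚ.Positive B
      B⁺ = ℚ.positive 0<B
      B≠0 : ℚ.NonZero B
      B≠0 = ℚ.pos⇒nonZero B
    0<1/B : 0ℚ ℚ.< ℚ.1/ B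
    0<1/B = ℚ.positive⁻¹ (ℚ.1/ B) {{ℚ.1/pos⇒pos B}}
    close : ∀ {a b c} → ∣ a ∣ ℚ.≤ B → ∣ b ℚ.- c ∣ ℚ.< ℚ.1/ B ℚ.* ε →
            ∣ a ℚ.* b ℚ.- a ℚ.* c ∣ ℚ.< ε
    close {a} {b} {c} ∣a∣≤B d<δ = begin-strict
      ∣ a ℚ.* b ℚ.- a ℚ.* c ∣   ≡⟨ cong ∣_∣ (solve 3 (λ a b c → a :* b :- a :* c := a :* (b :- c)) refl a b c) ⟩
      ∣ a ℚ.* (b ℚ.- c) ∣       ≡⟨ ℚ.∣p*q∣≡∣p∣*∣q∣ a (b ℚ.- c) ⟩
      ∣ a ∣ ℚ.* ∣ b ℚ.- c ∣     ≤⟨ ℚ.*-monoʳ-≤-nonNeg ∣ b ℚ.- c ∣ {{ℚ.nonNegative (ℚ.0≤∣p∣ (b ℚ.- c))}} ∣a∣≤B ⟩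
      B ℚ.* ∣ b ℚ.- c ∣         <⟨ ℚ.*-monoʳ-<-pos B d<δ ⟩
      B ℚ.* (ℚ.1/ B ℚ.* ε)      ≡⟨ ℚ.*-assoc B (ℚ.1/ B) ε ⟨
      B ℚ.* ℚ.1/ B ℚ.* ε        ≡⟨ cong (ℚ._* ε) (ℚ.*-inverseʳ B) ⟩
      1ℚ ℚ.* ε                  ≡⟨ ℚ.*-identityˡ ε ⟩
      ε                         ∎
      where
      open ℚ.≤-Reasoning
      open +-*-Solver using (solve; _:=_; _:*_; _:-_)

  *-congˡ : ∀ {x y z} → y ≈ z → x * y ≈ x * z
  *-congˡ {x} {y} {z} y≈z ε 0<ε =
    let (B , 0<B , bounded) = eventually-bounded x
        (δ , 0<δ , close)   = *-near 0<B 0<ε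
    in ev-zip (λ n → close {seq x n} {seq y n} {seq z n}) bounded (y≈z δ 0<δ)

  *-comm : ∀ x y → x * y ≈ y * x
  *-comm x y = pointwise {x * y} {y * x} λ n → ℚ.*-comm (seq x n) (seq y n)

  *-cong : ∀ {x y u v} → x ≈ y → u ≈ v → x * u ≈ y * v
  *-cong {x} {y} {u} {v} x≈y u≈v =
    ≈-trans {x * u} {x * v} {y * v} (*-congˡ {x} {u} {v} u≈v)
      (≈-trans {x * v} {v * x} {y * v} (*-comm x v)
        (≈-trans {v * x} {v * y} {y * v} (*-congˡ {v} {x} {y} x≈y) (*-comm v y)))

  +-*-commutativeRing : CommutativeRing 0ℓ 0ℓ
  +-*-commutativeRing = record
    { Carrier = ℝ ; _≈_ = _≈_ ; _+_ = _+_ ; _*_ = _*_ ; -_ = -_ ; 0# = 0ℝ ; 1# = 1ℝ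
    ; isCommutativeRing = record
      { isRing = record
        { +-isAbelianGroup = record
          { isGroup = record
            { isMonoid = record
              { isSemigroup = record
                { isMagma = record
                  { isEquivalence = record
                    { refl  = λ {x} → ≈-refl {x}
                    ; sym   = λ {x y} → ≈-sym {x} {y}
                    ; trans = λ {x y z} → ≈-trans {x} {y} {z}
                    }
                  ; ∙-cong = λ {x y u v} → +-cong {x} {y} {u} {v}
                  }
                ; assoc = λ x y z → pointwise {(x + y) + z} {x + (y + z)}
                    λ n → ℚ.+-assoc (seq x n) (seq y n) (seq z n)
                }
              ; identity = (λ x → pointwise {0ℝ + x} {x} λ n → ℚ.+-identityˡ (seq x n))
                         , (λ x → pointwise {x + 0ℝ} {x} λ n → ℚ.+-identityʳ (seq x n))
              }
            ; inverse = (λ x → pointwise {(- x) + x} {0ℝ} λ n → ℚ.+-inverseˡ (seq x n))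
                      , (λ x → pointwise {x + (- x)} {0ℝ} λ n → ℚ.+-inverseʳ (seq x n))
            ; ⁻¹-cong = λ {x y} → neg-cong {x} {y}
            }
          ; comm = λ x y → pointwise {x + y} {y + x} λ n → ℚ.+-comm (seq x n) (seq y n)
          }
        ; *-cong = λ {x y u v} → *-cong {x} {y} {u} {v}
        ; *-assoc = λ x y z → pointwise {(x * y) * z} {x * (y * z)}
            λ n → ℚ.*-assoc (seq x n) (seq y n) (seq z n)
        ; *-identity = (λ x → pointwise {1ℝ * x} {x} λ n → ℚ.*-identityˡ (seq x n))
                     , (λ x → pointwise {x * 1ℝ} {x} λ n → ℚ.*-identityʳ (seq x n))
        ; distrib = (λ x y z → pointwise {x * (y + z)} {x * y + x * z}
                      λ n → ℚ.*-distribˡ-+ (seq x n) (seq y n) (seq z n))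
                  , (λ x y z → pointwise {(y + z) * x} {y * x + z * x}
                      λ n → ℚ.*-distribʳ-+ (seq x n) (seq y n) (seq z n))
        }
      ; *-comm = *-comm
      }
    }

  -- The two alternatives overlap, so a single rational comparison can choose between them: it is
  -- made at an index past which `x - y` moves by less than a quarter of `ε`.
  ≤-or-separated : ∀ x y ε → 0ℚ ℚ.< ε →
    Eventually (λ n → seq x n ℚ.≤ seq y n ℚ.+ ε) ⊎
    ∃[ δ ] (0ℚ ℚ.< δ × Eventually (λ n → seq y n ℚ.+ δ ℚ.≤ seq x n))
  ≤-or-separated x y ε 0<ε =
    let (N , close) = cauchy (x - y) (ℚ.½ ℚ.* (ℚ.½ ℚ.* ε)) (half-pos (half-pos 0<ε))
    in [ (λ d≤ → inj₁ (N , λ n N≤n →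
           near-≤ {ε} {seq x n} {seq y n} {seq x N} {seq y N} 0<ε (close n N N≤n ℕ.≤-refl) d≤))
       , (λ d> → inj₂ (_ , half-pos (half-pos 0<ε) , N , λ n N≤n →
           near-> {ε} {seq x n} {seq y n} {seq x N} {seq y N} (close N n ℕ.≤-refl N≤n) d>))
       ]′ (≤-or-> (seq x N ℚ.- seq y N) (ℚ.½ ℚ.* ε))

  separated⇒≰ : ∀ {x y δ} → 0ℚ ℚ.< δ → Eventually (λ n → seq y n ℚ.+ δ ℚ.≤ seq x n) → ¬ x ≤ y
  separated⇒≰ {x} {y} {δ} 0<δ apart x≤y = ev-⊥
    (ev-zip (λ n → gap {δ} {seq x n} {seq y n} 0<δ) apart (x≤y (ℚ.½ ℚ.* δ) (half-pos 0<δ)))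

  separated⇒≥ : ∀ {x y δ} → 0ℚ ℚ.< δ → Eventually (λ n → seq y n ℚ.+ δ ℚ.≤ seq x n) → y ≤ x
  separated⇒≥ {x} {y} {δ} 0<δ apart ε 0<ε =
    ev-map (λ n → slack {δ} {ε} {seq x n} {seq y n} 0<δ 0<ε) apart

  -- For each `ε` the approximate decision either gives the inequality or separates `x` above `y`,
  -- and a separation refutes `x ≤ y` outright.
  ≤-stable : ∀ {x y} → ¬ ¬ (x ≤ y) → x ≤ y
  ≤-stable {x} {y} ¬x≰y ε 0<ε =
    [ (λ x≤y+ε → x≤y+ε)
    , (λ (δ , 0<δ , apart) → contradiction (separated⇒≰ {x} {y} {δ} 0<δ apart) ¬x≰y)
    ]′ (≤-or-separated x y ε 0<ε)

  ≰⇒≥ : ∀ {x y} → ¬ (x ≤ y) → y ≤ x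
  ≰⇒≥ {x} {y} x≰y ε 0<ε =
    [ (λ y≤x+ε → y≤x+ε)
    , (λ (δ , 0<δ , apart) → contradiction (separated⇒≥ {y} {x} {δ} 0<δ apart) x≰y)
    ]′ (≤-or-separated y x ε 0<ε)

  -- The contradiction falls on the other factor: if `y` stayed above some positive `δ`, the bounds
  -- `η * δ` on the product would give `x ≤ η` for every positive `η`.
  *-cancelˡ-≤0 : ∀ {x y} → ¬ (x ≤ 0ℝ) → x * y ≤ 0ℝ → y ≤ 0ℝ
  *-cancelˡ-≤0 {x} {y} x≰0 xy≤0 ε 0<ε =
    [ (λ y≤ε → y≤ε)
    , (λ (δ , 0<δ , apart) → contradiction
        (λ η 0<η → ev-zip (λ n → *-small {δ} {η} {seq x n} {seq y n} 0<δ 0<η) apart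
                          (xy≤0 (η ℚ.* δ) (*-pos 0<η 0<δ)))
        x≰0)
    ]′ (≤-or-separated y 0ℝ ε 0<ε)

  fromℚ-mono-≤ : ∀ {p q} → p ℚ.≤ q → fromℚ p ≤ fromℚ q
  fromℚ-mono-≤ {q = q} p≤q ε 0<ε = 0 , λ _ _ → ℚ.≤-trans p≤q (ℚ.<⇒≤ (p<p+q q 0<ε))

  1≰0 : ¬ (1ℝ ≤ 0ℝ)
  1≰0 = separated⇒≰ {1ℝ} {0ℝ} {1ℚ} (ℚ.positive⁻¹ 1ℚ) (0 , λ _ _ → ℚ.≤-refl)

  fromℚ-homo : ℚ.+-*-rawRing -Raw-AlmostCommutative⟶ fromCommutativeRing +-*-commutativeRing
  fromℚ-homo = record
    { ⟦_⟧    = fromℚ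
    ; +-homo = λ p q → pointwise {fromℚ (p ℚ.+ q)} {fromℚ p + fromℚ q} λ _ → refl
    ; *-homo = λ p q → pointwise {fromℚ (p ℚ.* q)} {fromℚ p * fromℚ q} λ _ → refl
    ; -‿homo = λ p → pointwise {fromℚ (ℚ.- p)} { - fromℚ p} λ _ → refl
    ; 0-homo = pointwise {0ℝ} {0ℝ} λ _ → refl
    ; 1-homo = pointwise {1ℝ} {1ℝ} λ _ → refl
    }

-- Counting with sums of indicators

module Counting where
  open import Data.Nat.Base
  open import Algebra.Properties.Semiring.Sum ℕ.+-*-semiring public

  ⟦_⟧ : ∀ {A : Set} → Dec A → ℕ
  ⟦ a? ⟧ = if does a? then 1 else 0

  ⟦⟧-true : ∀ {A : Set} (a? : Dec A) → A → ⟦ a? ⟧ ≡ 1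
  ⟦⟧-true a? a rewrite dec-true a? a = refl

  ⟦⟧-false : ∀ {A : Set} (a? : Dec A) → ¬ A → ⟦ a? ⟧ ≡ 0
  ⟦⟧-false a? ¬a rewrite dec-false a? ¬a = refl

  ⟦⟧≤1 : ∀ {A : Set} (a? : Dec A) → ⟦ a? ⟧ ≤ 1
  ⟦⟧≤1 (yes _) = s≤s z≤n
  ⟦⟧≤1 (no  _) = z≤n

  ⟦⟧-× : ∀ {A B : Set} (a? : Dec A) (b? : Dec B) → ⟦ a? ⟧ * ⟦ b? ⟧ ≡ ⟦ a? ×-dec b? ⟧
  ⟦⟧-× (yes _) (yes _) = refl
  ⟦⟧-× (yes _) (no  _) = refl
  ⟦⟧-× (no  _) _       = refl

  sum-mono-≤ : ∀ {n} {f g : Fin n → ℕ} → (∀ i → f i ≤ g i) → sum f ≤ sum g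
  sum-mono-≤ {zero}  f≤g = z≤n
  sum-mono-≤ {suc n} f≤g = ℕ.+-mono-≤ (f≤g zero) (sum-mono-≤ (f≤g ∘ suc))

  sum-mono-< : ∀ {n} {f g : Fin n → ℕ} → (∀ i → f i ≤ g i) → ∀ k → f k < g k → sum f < sum g
  sum-mono-< f≤g zero    fk<gk = ℕ.+-mono-<-≤ fk<gk (sum-mono-≤ (f≤g ∘ suc))
  sum-mono-< f≤g (suc k) fk<gk = ℕ.+-mono-≤-< (f≤g zero) (sum-mono-< (f≤g ∘ suc) k fk<gk)

  term≤sum : ∀ {n} (f : Fin n → ℕ) k → f k ≤ sum f
  term≤sum f zero    = ℕ.m≤m+n (f zero) _
  term≤sum f (suc k) = ℕ.≤-trans (term≤sum (f ∘ suc) k) (ℕ.m≤n+m _ (f zero))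

  sum-const-1 : ∀ n → sum {n} (λ _ → 1) ≡ n
  sum-const-1 zero    = refl
  sum-const-1 (suc n) = cong suc (sum-const-1 n)

  sum-zero : ∀ {n} {f : Fin n → ℕ} → (∀ i → f i ≡ 0) → sum f ≡ 0
  sum-zero {zero}  f≡0 = refl
  sum-zero {suc n} f≡0 = cong₂ _+_ (f≡0 zero) (sum-zero (f≡0 ∘ suc))

  sum-δ : ∀ {n} u (f : Fin n → ℕ) → sum (λ v → ⟦ u ≟ v ⟧ * f v) ≡ f u
  sum-δ zero    f = trans
    (cong₂ _+_ (ℕ.+-identityʳ (f zero)) (sum-zero {f = λ v → ⟦ zero ≟ suc v ⟧ * f (suc v)} λ _ → refl))
    (ℕ.+-identityʳ (f zero))
  sum-δ (suc u) f = sum-δ u (f ∘ suc)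

  sum-⟦⟧≤1 : ∀ {n} {P : Fin n → Set} (P? : ∀ i → Dec (P i)) →
    (∀ {i j} → P i → P j → i ≡ j) → sum (λ i → ⟦ P? i ⟧) ≤ 1
  sum-⟦⟧≤1 {zero}  P? unique = z≤n
  sum-⟦⟧≤1 {suc n} P? unique with P? zero
  ... | no  _  = sum-⟦⟧≤1 (P? ∘ suc) λ p q → suc-injective (unique p q)
  ... | yes p₀ = ℕ.≤-reflexive (cong suc (sum-zero λ i →
    ⟦⟧-false (P? (suc i)) λ p → contradiction (unique p₀ p) λ ()))

  length-filter-tabulate : ∀ {n} {A : Set} {P : A → Set} (P? : ∀ a → Dec (P a)) (f : Fin n → A) →
    length (filter P? (tabulate f)) ≡ sum (λ i → ⟦ P? (f i) ⟧)
  length-filter-tabulate {zero}  P? f = refl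
  length-filter-tabulate {suc n} P? f with does (P? (f zero))
  ... | true  = cong suc (length-filter-tabulate P? (f ∘ suc))
  ... | false = length-filter-tabulate P? (f ∘ suc)

-- Degrees and walks of length 2

module Graphs where
  open import Data.Nat.Base
  open import Defs using (Graph; Adj; adj?; adj-sym; adj-irrefl; degree; Connected; Acyclic; _≅_; K)
  open import Relation.Binary.Construct.Closure.ReflexiveTransitive using (ε; _◅_)
  open Counting
  open _≅_

  another-vertex : ∀ {m} → 1 ≤ m → (u : Fin (suc m)) → ∃[ v ] u ≢ v
  another-vertex (s≤s _) zero    = suc zero , λ ()
  another-vertex (s≤s _) (suc u) = zero , λ ()

  entry : ∀ {n} → Graph n → Fin n → Fin n → ℕ
  entry G u v = ⟦ adj? G u v ⟧

  entry-sym : ∀ {n} (G : Graph n) u v → entry G u v ≡ entry G v u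
  entry-sym G u v with adj? G u v
  ... | yes uv = sym (⟦⟧-true (adj? G v u) (adj-sym G uv))
  ... | no ¬uv = sym (⟦⟧-false (adj? G v u) (¬uv ∘ adj-sym G))

  entry-irrefl : ∀ {n} (G : Graph n) u → entry G u u ≡ 0
  entry-irrefl G u = ⟦⟧-false (adj? G u u) (adj-irrefl G refl)

  degree≡sum : ∀ {n} (G : Graph n) u → degree G u ≡ sum (entry G u)
  degree≡sum G u = length-filter-tabulate (adj? G u) λ v → v

  module _ {n} (G : Graph n) where
    Adj⇒≢ : ∀ {u v} → Adj G u v → u ≢ v
    Adj⇒≢ uv u≡v = adj-irrefl G u≡v uv

    -- The entries of the square of the adjacency matrix: walks of length 2 from `u` to `x`.
    codegree : Fin n → Fin n → ℕ
    codegree u x = sum λ v → entry G u v * entry G v x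

    codegree-self : ∀ u → codegree u u ≡ degree G u
    codegree-self u = trans (sum-cong-≗ λ v → trans (cong (entry G u v *_) (entry-sym G v u)) (square (adj? G u v)))
                            (sym (degree≡sum G u))
      where
      square : ∀ {A : Set} (a? : Dec A) → ⟦ a? ⟧ * ⟦ a? ⟧ ≡ ⟦ a? ⟧
      square (yes _) = refl
      square (no  _) = refl

    neighbourDegrees : Fin n → ℕ
    neighbourDegrees u = sum λ v → entry G u v * degree G v

    -- Walks of length 2 from `u` are counted by their middle vertex on the left and by their end on
    -- the right.
    neighbourDegrees≡ : ∀ u → neighbourDegrees u ≡ sum (codegree u)
    neighbourDegrees≡ u = trans
      (sum-cong-≗ λ v → trans (cong (entry G u v *_) (degree≡sum G v)) (*-distribˡ-sum (entry G u v) (entry G v)))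
      (∑-comm λ v x → entry G u v * entry G v x)

    private
      -- The indicator of the closed neighbourhood. The factor `1` gives the diagonal term the shape
      -- that `sum-δ` evaluates.
      self-or-adjacent : Fin n → Fin n → ℕ
      self-or-adjacent u v = entry G u v + ⟦ u ≟ v ⟧ * 1

      self-or-adjacent≤1 : ∀ u v → self-or-adjacent u v ≤ 1
      self-or-adjacent≤1 u v with u ≟ v
      ... | yes refl = ℕ.≤-reflexive (cong (_+ 1) (entry-irrefl G u))
      ... | no  _    = subst (_≤ 1) (sym (ℕ.+-identityʳ _)) (⟦⟧≤1 (adj? G u v))

      sum-self-or-adjacent : ∀ u → sum (self-or-adjacent u) ≡ degree G u + 1
      sum-self-or-adjacent u = trans (∑-distrib-+ (entry G u) λ v → ⟦ u ≟ v ⟧ * 1)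
        (cong₂ _+_ (sym (degree≡sum G u)) (sum-δ u λ _ → 1))

    degree-bound : ∀ u → degree G u + 1 ≤ n
    degree-bound u = subst₂ _≤_ (sum-self-or-adjacent u) (sum-const-1 n)
      (sum-mono-≤ (self-or-adjacent≤1 u))

    -- A missed vertex `x` contributes 0 to a sum of `n` terms, each at most 1, so the closed
    -- neighbourhood would have fewer than `n` vertices.
    full-degree⇒adjacent : ∀ {c} → n ≤ degree G c + 1 → ∀ {x} → c ≢ x → Adj G c x
    full-degree⇒adjacent {c} n≤ {x} c≢x with adj? G c x
    ... | yes cx = cx
    ... | no ¬cx = contradiction
      (subst₂ _<_ (sum-self-or-adjacent c) (sum-const-1 n)
        (sum-mono-< (self-or-adjacent≤1 c) x (subst (_< 1) (sym not-counted) ℕ.z<s)))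
      (ℕ.≤⇒≯ n≤)
      where
      not-counted : self-or-adjacent c x ≡ 0
      not-counted = cong₂ _+_ (⟦⟧-false (adj? G c x) ¬cx) (cong (_* 1) (⟦⟧-false (c ≟ x) c≢x))

    HasFullDegree : Set
    HasFullDegree = ∃[ c ] n ≤ degree G c + 1

    hasFullDegree? : Dec HasFullDegree
    hasFullDegree? = any? λ c → n ℕ.≤? degree G c + 1

    adjacent⇒full-degree : ∀ {c} → (∀ {x} → c ≢ x → Adj G c x) → degree G c + 1 ≡ n
    adjacent⇒full-degree {c} adjacent = trans (sym (sum-self-or-adjacent c))
      (trans (sum-cong-≗ counted) (sum-const-1 n))
      where
      counted : ∀ v → self-or-adjacent c v ≡ 1
      counted v with c ≟ v
      ... | yes refl = cong (_+ 1) (entry-irrefl G c)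
      ... | no  c≢v  = cong (_+ 0) (⟦⟧-true (adj? G c v) (adjacent c≢v))

    connected⇒degree≥1 : Connected G → ∀ {u w} → u ≢ w → 1 ≤ degree G u
    connected⇒degree≥1 connected {u} {w} u≢w with connected u w
    ... | ε = contradiction refl u≢w
    ... | _◅_ {j = v} uv _ = subst₂ _≤_ (⟦⟧-true (adj? G u v) uv) (sym (degree≡sum G u)) (term≤sum (entry G u) v)

    -- Acyclic graphs: vertices within distance 2

    module _ (acyclic : Acyclic G) where
      no-triangle : ∀ {u v w} → Adj G u v → Adj G v w → ¬ Adj G w u
      no-triangle {u} {v} {w} uv vw wu = acyclic u (v ∷ w ∷ [])
        ( s≤s (s≤s z≤n)
        , (Adj⇒≢ uv ∷ ≢-sym (Adj⇒≢ wu) ∷ []) ∷ (Adj⇒≢ vw ∷ []) ∷ [] ∷ []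
        , uv ∷ vw ∷ wu ∷ [-] )

      no-4-cycle : ∀ {u v w x} → Adj G u v → Adj G v w → Adj G w x → Adj G x u → u ≢ w → ¬ v ≢ x
      no-4-cycle {u} {v} {w} {x} uv vw wx xu u≢w v≢x = acyclic u (v ∷ w ∷ x ∷ [])
        ( s≤s (s≤s z≤n)
        , (Adj⇒≢ uv ∷ u≢w ∷ ≢-sym (Adj⇒≢ xu) ∷ []) ∷ (Adj⇒≢ vw ∷ v≢x ∷ []) ∷ (Adj⇒≢ wx ∷ []) ∷ [] ∷ []
        , uv ∷ vw ∷ wx ∷ xu ∷ [-] )

      no-5-cycle : ∀ {u v w x y} → Adj G u v → Adj G v w → Adj G w x → Adj G x y → Adj G y u →
        u ≢ w → u ≢ x → v ≢ x → v ≢ y → ¬ w ≢ y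
      no-5-cycle {u} {v} {w} {x} {y} uv vw wx xy yu u≢w u≢x v≢x v≢y w≢y =
        acyclic u (v ∷ w ∷ x ∷ y ∷ [])
        ( s≤s (s≤s z≤n)
        , (Adj⇒≢ uv ∷ u≢w ∷ u≢x ∷ ≢-sym (Adj⇒≢ yu) ∷ []) ∷ (Adj⇒≢ vw ∷ v≢x ∷ v≢y ∷ [])
          ∷ (Adj⇒≢ wx ∷ w≢y ∷ []) ∷ (Adj⇒≢ xy ∷ []) ∷ [] ∷ []
        , uv ∷ vw ∷ wx ∷ xy ∷ yu ∷ [-] )

      -- Two common neighbours of `u` and `x` would close a 4-cycle.
      codegree≤1 : ∀ {u x} → u ≢ x → codegree u x ≤ 1
      codegree≤1 {u} {x} u≢x = subst (_≤ 1) (sym (sum-cong-≗ λ v → ⟦⟧-× (adj? G u v) (adj? G v x)))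
        (sum-⟦⟧≤1 (λ v → adj? G u v ×-dec adj? G v x) unique)
        where
        unique : ∀ {v w} → Adj G u v × Adj G v x → Adj G u w × Adj G w x → v ≡ w
        unique {v} {w} (uv , vx) (uw , wx) with v ≟ w
        ... | yes v≡w = v≡w
        ... | no  v≢w = ⊥-elim (no-4-cycle uv vx (adj-sym G wx) (adj-sym G uw) u≢x v≢w)

      no-common-neighbour⇒codegree≡0 : ∀ {u x} → (∀ {v} → Adj G u v → ¬ Adj G v x) → codegree u x ≡ 0
      no-common-neighbour⇒codegree≡0 {u} {x} none = sum-zero λ v →
        trans (⟦⟧-× (adj? G u v) (adj? G v x))
              (⟦⟧-false (adj? G u v ×-dec adj? G v x) λ (uv , vx) → none uv vx)

      -- Every x ≠ u is a neighbour of u or has at most one common neighbour with u, but not both.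
      reach≤1 : ∀ {u x} → u ≢ x → codegree u x + entry G u x ≤ 1
      reach≤1 {u} {x} u≢x with adj? G u x
      ... | yes ux = ℕ.≤-reflexive (cong (_+ 1) (no-common-neighbour⇒codegree≡0
                       λ uv vx → no-triangle uv vx (adj-sym G ux)))
      ... | no  _  = subst (_≤ 1) (sym (ℕ.+-identityʳ _)) (codegree≤1 u≢x)

      private
        -- The slot `x = u` is granted `degree G u` extra, because `codegree u u` is the degree.
        -- After summation the entries of row `u` contribute the same degree on the left, so it
        -- cancels and leaves the bound on `neighbourDegrees`.
        reach-term : ∀ u x →
          (codegree u x + entry G u x) + ⟦ u ≟ x ⟧ * 1 ≤ 1 + ⟦ u ≟ x ⟧ * degree G u
        reach-term u x with u ≟ x
        ... | yes refl = ℕ.≤-reflexive (trans (cong (λ k → k + 1)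
                (cong₂ _+_ (codegree-self u) (entry-irrefl G u)))
                (trans (ℕ.+-comm _ 1) refl))
        ... | no  u≢x  = subst (_≤ 1) (sym (ℕ.+-identityʳ _)) (reach≤1 u≢x)

        sum-reach : ∀ u → sum (λ x → (codegree u x + entry G u x) + ⟦ u ≟ x ⟧ * 1)
                        ≡ (neighbourDegrees u + 1) + degree G u
        sum-reach u = trans (∑-distrib-+ (λ x → codegree u x + entry G u x) λ x → ⟦ u ≟ x ⟧ * 1)
          (trans (cong₂ _+_ (trans (∑-distrib-+ (codegree u) (entry G u))
                     (cong₂ _+_ (sym (neighbourDegrees≡ u)) (sym (degree≡sum G u))))
                     (sum-δ u λ _ → 1))
          (trans (ℕ.+-assoc (neighbourDegrees u) _ 1)
          (trans (cong (λ x → neighbourDegrees u + x) (ℕ.+-comm (degree G u) 1))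
                 (sym (ℕ.+-assoc (neighbourDegrees u) 1 _)))))

        sum-slots : ∀ u → sum (λ x → 1 + ⟦ u ≟ x ⟧ * degree G u) ≡ n + degree G u
        sum-slots u = trans (∑-distrib-+ (λ _ → 1) λ x → ⟦ u ≟ x ⟧ * degree G u)
          (cong₂ _+_ (sum-const-1 n) (sum-δ u λ _ → degree G u))

      neighbourDegrees-bound : ∀ u → neighbourDegrees u + 1 ≤ n
      neighbourDegrees-bound u = ℕ.+-cancelʳ-≤ (degree G u) _ _
        (subst₂ _≤_ (sum-reach u) (sum-slots u) (sum-mono-≤ (reach-term u)))

      -- A vertex at distance more than 2 from `u` would leave its slot in the count empty, making
      -- the bound on `neighbourDegrees` strict.
      maximal⇒distance≤2 : ∀ {u x} → n ≤ neighbourDegrees u + 1 → u ≢ x → ¬ Adj G u x →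
        ∃[ v ] (Adj G u v × Adj G v x)
      maximal⇒distance≤2 {u} {x} n≤ u≢x ¬ux with any? (λ v → adj? G u v ×-dec adj? G v x)
      ... | yes common = common
      ... | no ¬common = contradiction
        (ℕ.+-cancelʳ-< (degree G u) _ _
          (subst₂ _<_ (sum-reach u) (sum-slots u)
            (sum-mono-< (reach-term u) x (subst₂ _<_ (sym left) (sym right) ℕ.z<s))))
        (ℕ.≤⇒≯ n≤)
        where
        left : (codegree u x + entry G u x) + ⟦ u ≟ x ⟧ * 1 ≡ 0
        left = cong₂ _+_ (cong₂ _+_ (no-common-neighbour⇒codegree≡0 λ uv vx → ¬common (_ , uv , vx))
                                    (⟦⟧-false (adj? G u x) ¬ux))
                         (cong (_* 1) (⟦⟧-false (u ≟ x) u≢x))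
        right : 1 + ⟦ u ≟ x ⟧ * degree G u ≡ 1
        right = cong (λ k → 1 + k * degree G u) (⟦⟧-false (u ≟ x) u≢x)

      module _ (maximal : ∀ u → n ≤ neighbourDegrees u + 1) where
        -- The ends `s` and `t` are at distance at most 2. Distance 0 closes a triangle, distance 1
        -- a 4-cycle, and a common neighbour `c` a 5-cycle; `c` is neither `u` nor `v`, since that
        -- would close a triangle.
        no-path-of-length-3 : ∀ {s u v t} → Adj G s u → Adj G u v → Adj G v t → s ≢ v → ¬ u ≢ t
        no-path-of-length-3 {s} {u} {v} {t} su uv vt s≢v u≢t with s ≟ t
        ... | yes refl = no-triangle su uv vt
        ... | no  s≢t with adj? G s t
        ...   | yes st = no-4-cycle su uv vt (adj-sym G st) s≢v u≢t
        ...   | no ¬st with maximal⇒distance≤2 (maximal s) s≢t ¬st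
        ...     | c , sc , ct = no-5-cycle su uv vt (adj-sym G ct) (adj-sym G sc) s≢v s≢t u≢t
                  (λ { refl → no-triangle uv vt (adj-sym G ct) })
                  (λ { refl → no-triangle su uv (adj-sym G sc) })

        -- If a path `u`, `v`, `t` leaves `u`, a second neighbour of `u` would extend it to length
        -- 3. So `v` is the only neighbour, and `neighbourDegrees u` is at most the degree of `v`,
        -- which is then the centre. Otherwise all neighbours of `u` are leaves, so
        -- `neighbourDegrees u` is at most the degree of `u`, and `u` is the centre.
        maximal⇒full-degree : Fin n → HasFullDegree
        maximal⇒full-degree u
          with any? (λ v → adj? G u v ×-dec any? (λ t → adj? G v t ×-dec ¬? (u ≟ t)))
        ... | yes (v , uv , t , vt , u≢t) = v , ℕ.≤-trans (maximal u) (ℕ.+-monoˡ-≤ 1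
              (subst (neighbourDegrees u ≤_) (sum-δ v (degree G)) (sum-mono-≤ only-v)))
          where
          only-v : ∀ w → entry G u w * degree G w ≤ ⟦ v ≟ w ⟧ * degree G w
          only-v w with v ≟ w | adj? G u w
          ... | yes _  | yes _  = ℕ.≤-refl
          ... | yes _  | no  _  = z≤n
          ... | no _   | no  _  = z≤n
          ... | no v≢w | yes uw = ⊥-elim (no-path-of-length-3 (adj-sym G uw) uv vt (≢-sym v≢w) u≢t)
        ... | no none = u , ℕ.≤-trans (maximal u) (ℕ.+-monoˡ-≤ 1
              (subst (neighbourDegrees u ≤_) (sym (degree≡sum G u)) (sum-mono-≤ leaf)))
          where
          leaf : ∀ v → entry G u v * degree G v ≤ entry G u v
          leaf v with adj? G u v
          ... | no  _  = z≤n
          ... | yes uv = subst (_≤ 1) (sym (trans (ℕ.+-identityʳ _) (degree≡sum G v)))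
                (sum-⟦⟧≤1 (adj? G v) λ vi vj → trans (sym (only-u vi)) (only-u vj))
            where
            only-u : ∀ {t} → Adj G v t → u ≡ t
            only-u {t} vt with u ≟ t
            ... | yes u≡t = u≡t
            ... | no  u≢t = contradiction (v , uv , t , vt , u≢t) none

  -- Stars up to isomorphism

  Exactly-one : ∀ {n} → Fin n → Fin n → Fin n → Set
  Exactly-one c u v = (u ≡ c × v ≢ c) ⊎ (u ≢ c × v ≡ c)

  IsStar : ∀ {n} → Graph n → Fin n → Set
  IsStar G c = ∀ u v → Adj G u v ⇔ Exactly-one c u v

  star-centre-degree : ∀ {n} (G : Graph n) {c} → IsStar G c → degree G c + 1 ≡ n
  star-centre-degree G {c} star = adjacent⇒full-degree G λ {x} c≢x →
    Equivalence.from (star c x) (inj₁ (refl , ≢-sym c≢x))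

  star-leaf-row : ∀ {n} (G : Graph n) {c} → IsStar G c → ∀ {u} → u ≢ c → ∀ v → entry G u v ≡ ⟦ c ≟ v ⟧
  star-leaf-row G {c} star {u} u≢c v with c ≟ v
  ... | yes refl = ⟦⟧-true (adj? G u v) (Equivalence.from (star u v) (inj₂ (u≢c , refl)))
  ... | no  c≢v  = ⟦⟧-false (adj? G u v) λ uv →
    [ (λ (u≡c , _) → u≢c u≡c) , (λ (_ , v≡c) → c≢v (sym v≡c)) ]′ (Equivalence.to (star u v) uv)

  star-leaf-degree : ∀ {n} (G : Graph n) {c} → IsStar G c → ∀ {u} → u ≢ c → degree G u ≡ 1
  star-leaf-degree G {c} star {u} u≢c = trans (degree≡sum G u) (trans
    (sum-cong-≗ λ v → trans (star-leaf-row G star u≢c v) (sym (ℕ.*-identityʳ _)))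
    (sum-δ c λ _ → 1))

  -- An edge between two vertices other than `c` would form a triangle with `c`.
  full-degree⇒star : ∀ {n} (G : Graph n) → Acyclic G → ∀ {c} → n ≤ degree G c + 1 → IsStar G c
  full-degree⇒star G acyclic {c} n≤ u v = mk⇔ to′ from′
    where
    adjacent : ∀ {x} → c ≢ x → Adj G c x
    adjacent = full-degree⇒adjacent G n≤
    to′ : Adj G u v → Exactly-one c u v
    to′ uv with u ≟ c | v ≟ c
    ... | yes u≡c | yes v≡c = contradiction (trans u≡c (sym v≡c)) (Adj⇒≢ G uv)
    ... | yes u≡c | no  v≢c = inj₁ (u≡c , v≢c)
    ... | no  u≢c | yes v≡c = inj₂ (u≢c , v≡c)
    ... | no  u≢c | no  v≢c = ⊥-elim (no-triangle G acyclic
            (adjacent (≢-sym u≢c)) uv (adj-sym G (adjacent (≢-sym v≢c))))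
    from′ : Exactly-one c u v → Adj G u v
    from′ (inj₁ (refl , v≢c)) = adjacent (≢-sym v≢c)
    from′ (inj₂ (u≢c , refl)) = adj-sym G (adjacent (≢-sym u≢c))

  K-isStar : ∀ m → IsStar (K 1 m) zero
  K-isStar m zero    zero    = mk⇔ (λ s≢s → contradiction refl s≢s)
                                   λ { (inj₁ (_ , z≢z)) → contradiction refl z≢z
                                     ; (inj₂ (z≢z , _)) → contradiction refl z≢z }
  K-isStar m zero    (suc v) = mk⇔ (λ _ → inj₁ (refl , λ ())) (λ _ ())
  K-isStar m (suc u) zero    = mk⇔ (λ _ → inj₂ ((λ ()) , refl)) (λ _ ())
  K-isStar m (suc u) (suc v) = mk⇔ (λ s≢s → contradiction refl s≢s)
                                   λ { (inj₁ (() , _)) ; (inj₂ (_ , ())) }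

  ↔-exactly-one : ∀ {m n} (π : Fin m ↔ Fin n) {c d} → Inverse.to π c ≡ d →
    ∀ u v → Exactly-one c u v ⇔ Exactly-one d (Inverse.to π u) (Inverse.to π v)
  ↔-exactly-one π {c} refl u v = mk⇔
    (λ { (inj₁ (p , q)) → inj₁ (cong to p , q ∘ injective)
       ; (inj₂ (p , q)) → inj₂ (p ∘ injective , cong to q) })
    (λ { (inj₁ (p , q)) → inj₁ (injective p , q ∘ cong to)
       ; (inj₂ (p , q)) → inj₂ (p ∘ cong to , injective q) })
    where
    open Inverse π using (to; from; strictlyInverseʳ)
    injective : ∀ {x y} → to x ≡ to y → x ≡ y
    injective {x} {y} eq = trans (sym (strictlyInverseʳ x)) (trans (cong from eq) (strictlyInverseʳ y))

  -- The centre determines all adjacencies of a star, so any bijection taking `c` to `zero` is an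
  -- isomorphism; a transposition is one.
  star⇒≅K : ∀ {m} (G : Graph (suc m)) {c} → IsStar G c → G ≅ K 1 m
  star⇒≅K {m} G {c} star = record
    { bijection = transpose c zero
    ; adj⇔adj   = λ u v →
        ⇔-sym (K-isStar m _ _) ⇔-∘ (↔-exactly-one (transpose c zero) c↦0 u v ⇔-∘ star u v)
    }
    where
    c↦0 : transpose c zero ⟨$⟩ʳ c ≡ zero
    c↦0 rewrite dec-true (c ≟ c) refl = refl

  ≅K⇒star : ∀ {m n} (G : Graph n) → G ≅ K 1 m → ∃[ c ] IsStar G c
  ≅K⇒star {m} G iso = Inverse.from (bijection iso) zero , λ u v →
    ⇔-sym (↔-exactly-one (bijection iso) (Inverse.strictlyInverseˡ (bijection iso) zero) u v)
    ⇔-∘ (K-isStar m _ _ ⇔-∘ adj⇔adj iso u v)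

-- Natural numbers inside the rationals

module Embedding where
  private
    ⌊_⌋ : ℕ → ℚ
    ⌊ j ⌋ = + j ℚ./ 1

    toℚᵘ-⌊⌋ : ∀ j → ℚ.toℚᵘ ⌊ j ⌋ ℚᵘ.≃ mkℚᵘ (+ j) 0
    toℚᵘ-⌊⌋ j = ℚ.toℚᵘ-fromℚᵘ (mkℚᵘ (+ j) 0)

  /1-homo-+ : ∀ j k → ⌊ j ℕ.+ k ⌋ ≡ ⌊ j ⌋ ℚ.+ ⌊ k ⌋
  /1-homo-+ j k = ℚ.toℚᵘ-injective (begin-equality
    ℚ.toℚᵘ ⌊ j ℕ.+ k ⌋                     ≃⟨ toℚᵘ-⌊⌋ (j ℕ.+ k) ⟩
    mkℚᵘ (+ (j ℕ.+ k)) 0                   ≃⟨ *≡* (cong (ℤ._* + 1)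
                                                (cong₂ ℤ._+_ (sym (ℤ.*-identityʳ (+ j))) (sym (ℤ.*-identityʳ (+ k))))) ⟩
    mkℚᵘ (+ j) 0 ℚᵘ.+ mkℚᵘ (+ k) 0         ≃⟨ ℚᵘ.+-cong (toℚᵘ-⌊⌋ j) (toℚᵘ-⌊⌋ k) ⟨
    ℚ.toℚᵘ ⌊ j ⌋ ℚᵘ.+ ℚ.toℚᵘ ⌊ k ⌋         ≃⟨ ℚ.toℚᵘ-homo-+ ⌊ j ⌋ ⌊ k ⌋ ⟨
    ℚ.toℚᵘ (⌊ j ⌋ ℚ.+ ⌊ k ⌋)               ∎)
    where open ℚᵘ.≤-Reasoning

  /1-homo-* : ∀ j k → ⌊ j ℕ.* k ⌋ ≡ ⌊ j ⌋ ℚ.* ⌊ k ⌋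
  /1-homo-* j k = ℚ.toℚᵘ-injective (begin-equality
    ℚ.toℚᵘ ⌊ j ℕ.* k ⌋                     ≃⟨ toℚᵘ-⌊⌋ (j ℕ.* k) ⟩
    mkℚᵘ (+ (j ℕ.* k)) 0                   ≃⟨ *≡* (cong (ℤ._* + 1) (ℤ.pos-* j k)) ⟩
    mkℚᵘ (+ j) 0 ℚᵘ.* mkℚᵘ (+ k) 0         ≃⟨ ℚᵘ.*-cong (toℚᵘ-⌊⌋ j) (toℚᵘ-⌊⌋ k) ⟨
    ℚ.toℚᵘ ⌊ j ⌋ ℚᵘ.* ℚ.toℚᵘ ⌊ k ⌋         ≃⟨ ℚ.toℚᵘ-homo-* ⌊ j ⌋ ⌊ k ⌋ ⟨
    ℚ.toℚᵘ (⌊ j ⌋ ℚ.* ⌊ k ⌋)               ∎)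
    where open ℚᵘ.≤-Reasoning

  /1-mono-≤ : ∀ {j k} → j ℕ.≤ k → ⌊ j ⌋ ℚ.≤ ⌊ k ⌋
  /1-mono-≤ {j} {k} j≤k = ℚ.toℚᵘ-cancel-≤ (begin
    ℚ.toℚᵘ ⌊ j ⌋     ≃⟨ toℚᵘ-⌊⌋ j ⟩
    mkℚᵘ (+ j) 0     ≤⟨ ℚᵘ.*≤* (ℤ.*-monoʳ-≤-nonNeg (+ 1) (ℤ.+≤+ j≤k)) ⟩
    mkℚᵘ (+ k) 0     ≃⟨ toℚᵘ-⌊⌋ k ⟨
    ℚ.toℚᵘ ⌊ k ⌋     ∎)
    where open ℚᵘ.≤-Reasoning

-- Ordered algebras over the rationals with a stable order

record ClassicalOrderedAlgebra : Set₁ where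
  field
    commutativeRing : CommutativeRing 0ℓ 0ℓ
    algebra : ℚ.+-*-rawRing -Raw-AlmostCommutative⟶ fromCommutativeRing commutativeRing

  open CommutativeRing commutativeRing public
    hiding (1#; _≉_)
    renaming (refl to ≈-refl; sym to ≈-sym; trans to ≈-trans; zero to *-zero)
  open _-Raw-AlmostCommutative⟶_ algebra public renaming (⟦_⟧ to ι)

  infix 4 _≤_
  field
    _≤_           : Rel Carrier 0ℓ
    ≤-reflexive   : ∀ {x y} → x ≈ y → x ≤ y
    ≤-trans       : ∀ {x y z} → x ≤ y → y ≤ z → x ≤ z
    ≤-antisym     : ∀ {x y} → x ≤ y → y ≤ x → x ≈ y
    +-mono-≤      : ∀ {x y u v} → x ≤ y → u ≤ v → x + u ≤ y + v
    ≤-stable      : ∀ {x y} → ¬ ¬ (x ≤ y) → x ≤ y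
    ≰⇒≥           : ∀ {x y} → ¬ (x ≤ y) → y ≤ x
    *-cancelˡ-≤0  : ∀ {x y} → ¬ (x ≤ ι 0ℚ) → x * y ≤ ι 0ℚ → y ≤ ι 0ℚ
    ι-mono-≤      : ∀ {p q} → p ℚ.≤ q → ι p ≤ ι q
    ι-1≰0         : ¬ (ι 1ℚ ≤ ι 0ℚ)
    -- Kept opaque: + k / 1 unfolds to a gcd computation when k is a variable.
    fromℕ         : ℕ → Carrier
    fromℕ≡ι       : ∀ k → fromℕ k ≡ ι (+ k ℚ./ 1)

-- Order and arithmetic in such an algebra

module Theory (F : ClassicalOrderedAlgebra) where
  open ClassicalOrderedAlgebra F
  open Embedding

  𝟘 𝟙 𝟚 𝟜 ½ : Carrier
  𝟘 = ι 0ℚ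
  𝟙 = ι 1ℚ
  𝟚 = ι (+ 2 ℚ./ 1)
  𝟜 = ι (+ 4 ℚ./ 1)
  ½ = ι ℚ.½

  infix 4 _≟ᶜ_
  _≟ᶜ_ : ∀ p q → Maybe (ι p ≈ ι q)
  p ≟ᶜ q with p ℚ.≟ q
  ... | yes p≡q = just (reflexive (cong ι p≡q))
  ... | no  _   = nothing

  open import Algebra.Solver.Ring ℚ.+-*-rawRing (fromCommutativeRing commutativeRing) algebra _≟ᶜ_
    using (Polynomial; solve; _:=_; _:+_; _:*_; _:-_; :-_; con)

  nat : ∀ {k} → ℕ → Polynomial k
  nat j = con (+ j ℚ./ 1)

  poset : Poset 0ℓ 0ℓ 0ℓ
  poset = record
    { _≈_ = _≈_ ; _≤_ = _≤_
    ; isPartialOrder = record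
      { isPreorder = record
        { isEquivalence = isEquivalence ; reflexive = ≤-reflexive ; trans = ≤-trans }
      ; antisym = ≤-antisym
      }
    }

  open Poset poset using () renaming (refl to ≤-refl)
  open import Relation.Binary.Reasoning.PartialOrder poset
  open import Algebra.Properties.Semiring.Sum semiring

  translate-≤ : ∀ c {x y x′ y′} → x + c ≈ x′ → y + c ≈ y′ → x ≤ y → x′ ≤ y′
  translate-≤ c {x} {y} {x′} {y′} eq eq′ x≤y = begin
    x′     ≈⟨ eq ⟨
    x + c  ≤⟨ +-mono-≤ x≤y ≤-refl ⟩
    y + c  ≈⟨ eq′ ⟩
    y′     ∎

  x≤y⇒0≤y-x : ∀ {x y} → x ≤ y → 𝟘 ≤ y - x
  x≤y⇒0≤y-x {x} {y} = translate-≤ (- x) (solve 1 (λ x → x :- x := nat 0) ≈-refl x) ≈-refl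

  0≤y-x⇒x≤y : ∀ {x y} → 𝟘 ≤ y - x → x ≤ y
  0≤y-x⇒x≤y {x} {y} = translate-≤ x (solve 1 (λ x → nat 0 :+ x := x) ≈-refl x)
                                    (solve 2 (λ x y → (y :- x) :+ x := y) ≈-refl x y)

  x≤y⇒x-y≤0 : ∀ {x y} → x ≤ y → x - y ≤ 𝟘
  x≤y⇒x-y≤0 {x} {y} = translate-≤ (- y) ≈-refl (solve 1 (λ y → y :- y := nat 0) ≈-refl y)

  x-y≤0⇒x≤y : ∀ {x y} → x - y ≤ 𝟘 → x ≤ y
  x-y≤0⇒x≤y {x} {y} = translate-≤ y (solve 2 (λ x y → (x :- y) :+ y := x) ≈-refl x y)
                                    (solve 1 (λ y → nat 0 :+ y := y) ≈-refl y)

  0≤x⇒-x≤0 : ∀ {x} → 𝟘 ≤ x → - x ≤ 𝟘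
  0≤x⇒-x≤0 {x} = translate-≤ (- x) (solve 1 (λ x → nat 0 :- x := :- x) ≈-refl x)
                                   (solve 1 (λ x → x :- x := nat 0) ≈-refl x)

  x≤0⇒0≤-x : ∀ {x} → x ≤ 𝟘 → 𝟘 ≤ - x
  x≤0⇒0≤-x {x} = translate-≤ (- x) (solve 1 (λ x → x :- x := nat 0) ≈-refl x)
                                   (solve 1 (λ x → nat 0 :- x := :- x) ≈-refl x)

  0≤+ : ∀ {x y} → 𝟘 ≤ x → 𝟘 ≤ y → 𝟘 ≤ x + y
  0≤+ 0≤x 0≤y = ≤-trans (≤-reflexive (solve 0 (nat 0 := nat 0 :+ nat 0) ≈-refl)) (+-mono-≤ 0≤x 0≤y)

  x≤x+y : ∀ {x y} → 𝟘 ≤ y → x ≤ x + y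
  x≤x+y {x} 0≤y = ≤-trans (≤-reflexive (solve 1 (λ x → x := x :+ nat 0) ≈-refl x)) (+-mono-≤ ≤-refl 0≤y)

  x≤y+x : ∀ {x y} → 𝟘 ≤ y → x ≤ y + x
  x≤y+x 0≤y = ≤-trans (x≤x+y 0≤y) (≤-reflexive (+-comm _ _))

  *-zeroˡ′ : ∀ {x y} → x ≈ 𝟘 → x * y ≈ 𝟘
  *-zeroˡ′ {x} {y} x≈0 = ≈-trans (*-congʳ x≈0) (solve 1 (λ y → nat 0 :* y := nat 0) ≈-refl y)

  *-zeroʳ′ : ∀ {x y} → y ≈ 𝟘 → x * y ≈ 𝟘
  *-zeroʳ′ y≈0 = ≈-trans (*-comm _ _) (*-zeroˡ′ y≈0)

  -- If the product were not nonnegative, it would be at most zero and `x` could not be zero;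
  -- cancelling `x` then makes `y` zero, and with it the product.
  0≤* : ∀ {x y} → 𝟘 ≤ x → 𝟘 ≤ y → 𝟘 ≤ x * y
  0≤* {x} {y} 0≤x 0≤y = ≤-stable λ 0≰xy → 0≰xy (≤-reflexive (≈-sym (*-zeroʳ′
    (≤-antisym (*-cancelˡ-≤0 (λ x≤0 → 0≰xy (≤-reflexive (≈-sym (*-zeroˡ′ (≤-antisym x≤0 0≤x)))))
                             (≰⇒≥ 0≰xy)) 0≤y))))

  *-monoˡ-≤ : ∀ {x y z} → 𝟘 ≤ x → y ≤ z → x * y ≤ x * z
  *-monoˡ-≤ {x} {y} {z} 0≤x y≤z = 0≤y-x⇒x≤y (≤-trans (0≤* 0≤x (x≤y⇒0≤y-x y≤z))
    (≤-reflexive (solve 3 (λ x y z → x :* (z :- y) := x :* z :- x :* y) ≈-refl x y z)))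

  infix 4 0<_
  -- A negation instead of a positive lower bound: `*-cancelˡ-≤0` takes positivity in this form, and
  -- a failed inequality supplies it directly.
  0<_ : Carrier → Set
  0< x = ¬ (x ≤ 𝟘)

  0<⇒0≤ : ∀ {x} → 0< x → 𝟘 ≤ x
  0<⇒0≤ = ≰⇒≥

  0<* : ∀ {x y} → 0< x → 0< y → 0< x * y
  0<* 0<x 0<y xy≤0 = 0<y (*-cancelˡ-≤0 0<x xy≤0)

  ≰⇒0<- : ∀ {x y} → ¬ (x ≤ y) → 0< x - y
  ≰⇒0<- x≰y = x≰y ∘ x-y≤0⇒x≤y

  0<-mono : ∀ {x y} → x ≤ y → 0< x → 0< y
  0<-mono x≤y 0<x y≤0 = 0<x (≤-trans x≤y y≤0)

  -- The sign of `x` is free. If `x ≤ y` failed, `x + y` would be positive and could be cancelled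
  -- from `(x + y) * (x - y) ≤ 𝟘`.
  square-cancel-≤ : ∀ {x y} → 𝟘 ≤ y → x * x ≤ y * y → x ≤ y
  square-cancel-≤ {x} {y} 0≤y x²≤y² = ≤-stable λ x≰y →
    x≰y (x-y≤0⇒x≤y (*-cancelˡ-≤0 {x + y}
      (λ x+y≤0 → x≰y (≤-trans (≤-trans (x≤x+y 0≤y) x+y≤0) 0≤y))
      (≤-trans (≤-reflexive (solve 2 (λ x y → (x :+ y) :* (x :- y) := x :* x :- y :* y) ≈-refl x y))
               (x≤y⇒x-y≤0 x²≤y²))))

  fromℕ-mono-≤ : ∀ {i j} → i ℕ.≤ j → fromℕ i ≤ fromℕ j
  fromℕ-mono-≤ {i} {j} i≤j = subst₂ _≤_ (sym (fromℕ≡ι i)) (sym (fromℕ≡ι j)) (ι-mono-≤ (/1-mono-≤ i≤j))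

  fromℕ-homo-+ : ∀ i j → fromℕ (i ℕ.+ j) ≈ fromℕ i + fromℕ j
  fromℕ-homo-+ i j = begin-equality
    fromℕ (i ℕ.+ j)                      ≡⟨ trans (fromℕ≡ι (i ℕ.+ j)) (cong ι (/1-homo-+ i j)) ⟩
    ι ((+ i ℚ./ 1) ℚ.+ (+ j ℚ./ 1))          ≈⟨ +-homo _ _ ⟩
    ι (+ i ℚ./ 1) + ι (+ j ℚ./ 1)        ≡⟨ cong₂ _+_ (fromℕ≡ι i) (fromℕ≡ι j) ⟨
    fromℕ i + fromℕ j                    ∎

  fromℕ-homo-* : ∀ i j → fromℕ (i ℕ.* j) ≈ fromℕ i * fromℕ j
  fromℕ-homo-* i j = begin-equality
    fromℕ (i ℕ.* j)                      ≡⟨ trans (fromℕ≡ι (i ℕ.* j)) (cong ι (/1-homo-* i j)) ⟩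
    ι ((+ i ℚ./ 1) ℚ.* (+ j ℚ./ 1))          ≈⟨ *-homo _ _ ⟩
    ι (+ i ℚ./ 1) * ι (+ j ℚ./ 1)        ≡⟨ cong₂ _*_ (fromℕ≡ι i) (fromℕ≡ι j) ⟨
    fromℕ i * fromℕ j                    ∎

  fromℕ-suc : ∀ j → fromℕ (suc j) ≈ 𝟙 + fromℕ j
  fromℕ-suc j = ≈-trans (fromℕ-homo-+ 1 j) (+-congʳ (reflexive (fromℕ≡ι 1)))

  fromℕ-cancel-≤ : ∀ {i j} → fromℕ i ≤ fromℕ j → i ℕ.≤ j
  fromℕ-cancel-≤ {i} {j} h with i ℕ.≤? j
  ... | yes i≤j = i≤j
  ... | no  i≰j = contradiction
    (translate-≤ (- fromℕ j) (solve 1 (λ k → (nat 1 :+ k) :- k := nat 1) ≈-refl (fromℕ j))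
                             (solve 1 (λ k → k :- k := nat 0) ≈-refl (fromℕ j))
      (≤-trans (≤-reflexive (≈-sym (fromℕ-suc j))) (≤-trans (fromℕ-mono-≤ (ℕ.≰⇒> i≰j)) h)))
    ι-1≰0

  0≤fromℕ : ∀ k → 𝟘 ≤ fromℕ k
  0≤fromℕ k = subst (_≤ fromℕ k) (fromℕ≡ι 0) (fromℕ-mono-≤ z≤n)

  -- Finite sums

  private
    variable
      n : ℕ

  sum-mono-≤ : {f g : Fin n → Carrier} → (∀ i → f i ≤ g i) → sum f ≤ sum g
  sum-mono-≤ {zero}  f≤g = ≤-refl
  sum-mono-≤ {suc n} f≤g = +-mono-≤ (f≤g zero) (sum-mono-≤ (f≤g ∘ suc))

  0≤sum : {f : Fin n → Carrier} → (∀ i → 𝟘 ≤ f i) → 𝟘 ≤ sum f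
  0≤sum {zero}  0≤f = ≤-reflexive 0-homo
  0≤sum {suc n} 0≤f = 0≤+ (0≤f zero) (0≤sum (0≤f ∘ suc))

  term≤sum : {f : Fin n → Carrier} → (∀ i → 𝟘 ≤ f i) → ∀ k → f k ≤ sum f
  term≤sum 0≤f zero    = x≤x+y (0≤sum (0≤f ∘ suc))
  term≤sum 0≤f (suc k) = ≤-trans (term≤sum (0≤f ∘ suc) k) (x≤y+x (0≤f zero))

  fromℕ-sum : (f : Fin n → ℕ) → fromℕ (Counting.sum f) ≈ sum (fromℕ ∘ f)
  fromℕ-sum {zero}  f = ≈-trans (reflexive (fromℕ≡ι 0)) 0-homo
  fromℕ-sum {suc n} f = ≈-trans (fromℕ-homo-+ (f zero) _) (+-congˡ (fromℕ-sum (f ∘ suc)))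

  sum-zero : {f : Fin n → Carrier} → (∀ i → f i ≈ 𝟘) → sum f ≈ 𝟘
  sum-zero {zero}  f≈0 = ≈-sym 0-homo
  sum-zero {suc n} f≈0 = ≈-trans (+-cong (f≈0 zero) (sum-zero (f≈0 ∘ suc)))
                                 (solve 0 (nat 0 :+ nat 0 := nat 0) ≈-refl)

  sum-δ : ∀ u t (f : Fin n → Carrier) →
    sum (λ v → (if does (u ≟ v) then t else 𝟘) * f v) ≈ t * f u
  sum-δ zero    t f = ≈-trans (+-congˡ (sum-zero {f = λ v → 𝟘 * f (suc v)} λ _ → *-zeroˡ′ ≈-refl))
                              (solve 1 (λ x → x :+ nat 0 := x) ≈-refl (t * f zero))
  sum-δ (suc u) t f = ≈-trans (+-cong (*-zeroˡ′ ≈-refl) (sum-δ u t (f ∘ suc)))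
                              (solve 1 (λ x → nat 0 :+ x := x) ≈-refl (t * f (suc u)))

  -- The double negation shift, by induction on a finite index set; it allows the signs of all
  -- entries of a vector to be chosen at once.
  ¬¬-∀ : {P : Fin n → Set} → (∀ i → ¬ ¬ P i) → ¬ ¬ (∀ i → P i)
  ¬¬-∀ {zero}  ¬¬p k = k λ ()
  ¬¬-∀ {suc n} ¬¬p k = ¬¬p zero λ p₀ → ¬¬-∀ (¬¬p ∘ suc) λ pₛ → k λ { zero → p₀ ; (suc i) → pₛ i }

  -- Symmetric nonnegative matrices

  _·_ : (Fin n → Fin n → Carrier) → (Fin n → Carrier) → Fin n → Carrier
  (M · x) i = sum λ j → M i j * x j

  IsEigenvalue : (Fin n → Fin n → Carrier) → Carrier → Set
  IsEigenvalue {n} M μ = Σ[ x ∈ (Fin n → Carrier) ]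
    ¬ (∀ i → x i ≈ 𝟘) × (∀ i → (M · x) i ≈ μ * x i)

  IsEigenvalue-cong : {M M′ : Fin n → Fin n → Carrier} → (∀ i j → M i j ≈ M′ i j) →
    ∀ {μ} → IsEigenvalue M μ → IsEigenvalue M′ μ
  IsEigenvalue-cong M≈M′ (x , x≉0 , Mx≈μx) =
    x , x≉0 , λ i → ≈-trans (sum-cong-≋ λ j → *-congʳ (≈-sym (M≈M′ i j))) (Mx≈μx i)

  module _ {M : Fin n → Fin n → Carrier}
    (M-sym : ∀ i j → M i j ≈ M j i) (M-nonneg : ∀ i j → 𝟘 ≤ M i j) where

    ·-mono : ∀ {x y} → (∀ i → x i ≤ y i) → ∀ i → (M · x) i ≤ (M · y) i
    ·-mono x≤y i = sum-mono-≤ λ j → *-monoˡ-≤ (M-nonneg i j) (x≤y j)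

    ·-neg : ∀ x i → (M · (λ j → - x j)) i ≈ - (M · x) i
    ·-neg x i = begin-equality
      sum (λ j → M i j * - x j)
        ≈⟨ sum-cong-≋ (λ j → solve 2 (λ m x → m :* :- x := con (ℚ.- 1ℚ) :* (m :* x)) ≈-refl (M i j) (x j)) ⟩
      sum (λ j → ι (ℚ.- 1ℚ) * (M i j * x j))
        ≈⟨ *-distribˡ-sum _ (λ j → M i j * x j) ⟨
      ι (ℚ.- 1ℚ) * (M · x) i
        ≈⟨ solve 1 (λ y → con (ℚ.- 1ℚ) :* y := :- y) ≈-refl ((M · x) i) ⟩
      - (M · x) i ∎

    ∑-self-adjoint : ∀ x y → sum (λ i → x i * (M · y) i) ≈ sum (λ i → y i * (M · x) i)
    ∑-self-adjoint x y = begin-equality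
      sum (λ i → x i * (M · y) i)                      ≈⟨ sum-cong-≋ (λ i → *-distribˡ-sum (x i) λ j → M i j * y j) ⟩
      sum (λ i → sum λ j → x i * (M i j * y j))        ≈⟨ ∑-comm (λ i j → x i * (M i j * y j)) ⟩
      sum (λ j → sum λ i → x i * (M i j * y j))        ≈⟨ sum-cong-≋ (λ j → sum-cong-≋ λ i → swap i j) ⟩
      sum (λ j → sum λ i → y j * (M j i * x i))        ≈⟨ sum-cong-≋ (λ j → ≈-sym (*-distribˡ-sum (y j) λ i → M j i * x i)) ⟩
      sum (λ j → y j * (M · x) j)                      ∎
      where
      swap : ∀ i j → x i * (M i j * y j) ≈ y j * (M j i * x i)
      swap i j = ≈-trans (*-congˡ (*-congʳ (M-sym i j)))
        (solve 3 (λ x m y → x :* (m :* y) := y :* (m :* x)) ≈-refl (x i) (M j i) (y j))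

    -- The entrywise absolute value of an eigenvector; absolute values exist only up to ¬¬.
    record NonnegSubeigenvector (μ : Carrier) : Set where
      field
        y       : Fin n → Carrier
        nonneg  : ∀ i → 𝟘 ≤ y i
        nonzero : ¬ (∀ i → y i ≤ 𝟘)
        sub     : ∀ i → μ * y i ≤ (M · y) i

    -- By the sign of `x i`, the product `μ * y i` is the entry at `i` of `M · x` or of its
    -- negative. Both `x` and `- x` lie below `y`, and `M` has nonnegative entries.
    subeigenvector : ∀ {μ} → IsEigenvalue M μ → ¬ ¬ NonnegSubeigenvector μ
    subeigenvector {μ} (x , x≉0 , Mx≈μx) k = ¬¬-∀ absolute λ abs → k (record
      { y       = λ i → proj₁ (abs i)
      ; nonneg  = λ i → 0≤∣x∣ (abs i)
      ; nonzero = λ y≤0 → x≉0 λ i → ≤-antisym (≤-trans (x≤∣x∣ (abs i)) (y≤0 i)) (0≤x (abs i) (y≤0 i))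
      ; sub     = λ i → sub abs i (proj₂ (abs i))
      })
      where
      Abs : Carrier → Set
      Abs x = Σ[ y ∈ Carrier ] (𝟘 ≤ y × y ≈ x ⊎ 𝟘 ≤ y × y ≈ - x)
      absolute : ∀ i → ¬ ¬ Abs (x i)
      -- `k` is used twice: were `x i` not nonnegative, `- x i` would serve and contradict `k`; so
      -- by stability `x i` itself serves.
      absolute i k = k (x i , inj₁ ((≤-stable λ 0≰x → k (- x i , inj₂ (x≤0⇒0≤-x (≰⇒≥ 0≰x) , ≈-refl))) , ≈-refl))
      0≤∣x∣ : ∀ {x} ((y , _) : Abs x) → 𝟘 ≤ y
      0≤∣x∣ (_ , inj₁ (0≤y , _)) = 0≤y
      0≤∣x∣ (_ , inj₂ (0≤y , _)) = 0≤y
      -∣x∣≤x : ∀ {x} ((y , _) : Abs x) → - y ≤ x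
      -∣x∣≤x (_ , inj₁ (0≤y , y≈x)) = ≤-trans (0≤x⇒-x≤0 0≤y) (≤-trans 0≤y (≤-reflexive y≈x))
      -∣x∣≤x {x} (_ , inj₂ (0≤y , y≈-x)) = ≤-reflexive (≈-trans
        (-‿cong y≈-x) (solve 1 (λ x → :- (:- x) := x) ≈-refl x))
      x≤∣x∣ : ∀ {x} ((y , _) : Abs x) → x ≤ y
      x≤∣x∣ (_ , inj₁ (0≤y , y≈x)) = ≤-reflexive (≈-sym y≈x)
      x≤∣x∣ {x} (y , inj₂ (0≤y , y≈-x)) = ≤-trans (≤-reflexive (≈-trans
        (solve 1 (λ x → x := :- (:- x)) ≈-refl x) (-‿cong (≈-sym y≈-x)))) (≤-trans (0≤x⇒-x≤0 0≤y) 0≤y)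
      -x≤∣x∣ : ∀ {x} ((y , _) : Abs x) → - x ≤ y
      -x≤∣x∣ {x} (y , inj₁ (0≤y , y≈x)) = ≤-trans (≤-reflexive (-‿cong (≈-sym y≈x))) (≤-trans (0≤x⇒-x≤0 0≤y) 0≤y)
      -x≤∣x∣ (y , inj₂ (0≤y , y≈-x)) = ≤-reflexive (≈-sym y≈-x)
      0≤x : ∀ {x} ((y , y≡) : Abs x) → y ≤ 𝟘 → 𝟘 ≤ x
      0≤x ax y≤0 = ≤-trans (x≤0⇒0≤-x y≤0) (-∣x∣≤x ax)
      sub : ∀ (abs : ∀ i → Abs (x i)) i →
        𝟘 ≤ proj₁ (abs i) × proj₁ (abs i) ≈ x i ⊎ 𝟘 ≤ proj₁ (abs i) × proj₁ (abs i) ≈ - x i →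
        μ * proj₁ (abs i) ≤ (M · λ j → proj₁ (abs j)) i
      sub abs i (inj₁ (_ , y≈x)) = begin
        μ * proj₁ (abs i)              ≈⟨ *-congˡ y≈x ⟩
        μ * x i                        ≈⟨ Mx≈μx i ⟨
        (M · x) i                      ≤⟨ ·-mono (λ j → x≤∣x∣ (abs j)) i ⟩
        (M · λ j → proj₁ (abs j)) i    ∎
      sub abs i (inj₂ (_ , y≈-x)) = begin
        μ * proj₁ (abs i)              ≈⟨ *-congˡ y≈-x ⟩
        μ * - x i                      ≈⟨ solve 2 (λ μ x → μ :* :- x := :- (μ :* x)) ≈-refl μ (x i) ⟩
        - (μ * x i)                    ≈⟨ -‿cong (Mx≈μx i) ⟨
        - (M · x) i                    ≈⟨ ·-neg x i ⟨
        (M · λ j → - x j) i            ≤⟨ ·-mono (λ j → -x≤∣x∣ (abs j)) i ⟩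
        (M · λ j → proj₁ (abs j)) i    ∎

    module Comparison {μ B} (w : Fin n → Carrier) (0<w : ∀ i → 0< w i)
      (super : ∀ i → (M · w) i ≤ B * w i) (v : NonnegSubeigenvector μ) where
      open NonnegSubeigenvector v

      private
        -- The slack of the supersolution weighted by `y`, and that of the subeigenvector weighted
        -- by `w`. They split `(B - μ) * total` into nonnegative terms, so in the equality case
        -- every single term vanishes.
        P Q : Fin n → Carrier
        P i = y i * (B * w i - (M · w) i)
        Q i = w i * ((M · y) i - μ * y i)

        0≤P : ∀ i → 𝟘 ≤ P i
        0≤P i = 0≤* (nonneg i) (x≤y⇒0≤y-x (super i))

        0≤Q : ∀ i → 𝟘 ≤ Q i
        0≤Q i = 0≤* (0<⇒0≤ (0<w i)) (x≤y⇒0≤y-x (sub i))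

        total : Carrier
        total = sum λ i → w i * y i

        0<total : 0< total
        0<total total≤0 = nonzero λ i → *-cancelˡ-≤0 (0<w i)
          (≤-trans (term≤sum (λ i → 0≤* (0<⇒0≤ (0<w i)) (nonneg i)) i) total≤0)

        -- Σ y (M w) = Σ w (M y) by symmetry, so these terms cancel.
        sum-P+Q : sum (λ i → P i + Q i) ≈ (B - μ) * total
        sum-P+Q = begin-equality
          sum (λ i → P i + Q i)     ≈⟨ solve 2 (λ s t → s := (s :+ t) :- t) ≈-refl _ yMw ⟩
          (sum (λ i → P i + Q i) + yMw) - yMw
            ≈⟨ +-congʳ (∑-distrib-+ (λ i → P i + Q i) (λ i → y i * (M · w) i)) ⟨
          sum (λ i → P i + Q i + y i * (M · w) i) - yMw
            ≈⟨ +-congʳ (sum-cong-≋ λ i → solve 6 (λ y w B Mw My μ →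
                 y :* (B :* w :- Mw) :+ w :* (My :- μ :* y) :+ y :* Mw :=
                 (B :- μ) :* (w :* y) :+ w :* My) ≈-refl (y i) (w i) B ((M · w) i) ((M · y) i) μ) ⟩
          sum (λ i → (B - μ) * (w i * y i) + w i * (M · y) i) - yMw
            ≈⟨ +-congʳ (∑-distrib-+ (λ i → (B - μ) * (w i * y i)) (λ i → w i * (M · y) i)) ⟩
          (sum (λ i → (B - μ) * (w i * y i)) + sum (λ i → w i * (M · y) i)) - yMw
            ≈⟨ +-cong (+-cong (≈-sym (*-distribˡ-sum (B - μ) λ i → w i * y i)) (∑-self-adjoint w y)) ≈-refl ⟩
          ((B - μ) * total + yMw) - yMw
            ≈⟨ solve 2 (λ s t → (s :+ t) :- t := s) ≈-refl _ yMw ⟩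
          (B - μ) * total ∎
          where
          yMw = sum λ i → y i * (M · w) i

      μ≤B : μ ≤ B
      μ≤B = x-y≤0⇒x≤y (*-cancelˡ-≤0 0<total (begin
        total * (μ - B)             ≈⟨ solve 3 (λ t μ B → t :* (μ :- B) := :- ((B :- μ) :* t)) ≈-refl total μ B ⟩
        - ((B - μ) * total)         ≈⟨ -‿cong sum-P+Q ⟨
        - sum (λ i → P i + Q i)     ≤⟨ 0≤x⇒-x≤0 (0≤sum λ i → 0≤+ (0≤P i) (0≤Q i)) ⟩
        𝟘                           ∎))

      module _ (μ≈B : μ ≈ B) where
        private
          P+Q≤0 : ∀ i → P i + Q i ≤ 𝟘
          P+Q≤0 i = begin
            P i + Q i                ≤⟨ term≤sum (λ i → 0≤+ (0≤P i) (0≤Q i)) i ⟩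
            sum (λ i → P i + Q i)    ≈⟨ sum-P+Q ⟩
            (B - μ) * total          ≈⟨ *-zeroˡ′ (≈-trans (+-congˡ (-‿cong μ≈B)) (solve 1 (λ B → B :- B := nat 0) ≈-refl B)) ⟩
            𝟘                        ∎

        y*slack≤0 : ∀ i → y i * (B * w i - (M · w) i) ≤ 𝟘
        y*slack≤0 i = ≤-trans (x≤x+y (0≤Q i)) (P+Q≤0 i)

        My≤μy : ∀ i → (M · y) i ≤ μ * y i
        My≤μy i = x-y≤0⇒x≤y (*-cancelˡ-≤0 (0<w i) (≤-trans (x≤y+x (0≤P i)) (P+Q≤0 i)))

    supersolution-bound : ∀ {μ B} w → (∀ i → 0< w i) → (∀ i → (M · w) i ≤ B * w i) →
      NonnegSubeigenvector μ → μ ≤ B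
    supersolution-bound {μ} {B} = Comparison.μ≤B {μ} {B}

    supersolution-tight : ∀ {μ B} w → (∀ i → 0< w i) → (∀ i → (M · w) i ≤ B * w i) →
      (v : NonnegSubeigenvector μ) → μ ≈ B → let open NonnegSubeigenvector v in
      ∀ i → y i * (B * w i - (M · w) i) ≤ 𝟘 × (M · y) i ≤ μ * y i
    supersolution-tight {μ} {B} w 0<w super v μ≈B i =
      Comparison.y*slack≤0 {μ} {B} w 0<w super v μ≈B i , Comparison.My≤μy {μ} {B} w 0<w super v μ≈B i

  -- The matrix of a graph acting on functions of the degree

  module _ (α : Carrier) (0≤α : 𝟘 ≤ α) (α≤1 : α ≤ 𝟙) {m : ℕ} where
    open import Defs using (Graph; Adj; adj?; degree; Connected; Acyclic; _≅_; K)
    open Graphs using (neighbourDegrees; neighbourDegrees-bound; degree≡sum; degree-bound;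
      HasFullDegree; hasFullDegree?; connected⇒degree≥1; maximal⇒full-degree; IsStar; full-degree⇒star; star⇒≅K; ≅K⇒star)
    open import Relation.Binary.Construct.Closure.ReflexiveTransitive using (Star; ε; _◅_)

    -- The order is n = suc m; thus N = n and k = n − 1.
    N k : Carrier
    N = fromℕ (suc m)
    k = fromℕ m

    N≈1+k : N ≈ 𝟙 + k
    N≈1+k = fromℕ-suc m

    0≤1-α : 𝟘 ≤ 𝟙 - α
    0≤1-α = x≤y⇒0≤y-x α≤1

    module _ (G : Graph (suc m)) where
      A D Aα : Fin (suc m) → Fin (suc m) → Carrier
      A u v  = if does (adj? G u v) then 𝟙 else 𝟘
      D u v  = if does (u ≟ v) then fromℕ (degree G u) else 𝟘
      Aα u v = α * D u v + (𝟙 - α) * A u v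

      d S : Fin (suc m) → Carrier
      d u = fromℕ (degree G u)
      S u = fromℕ (neighbourDegrees G u)

      A≡fromℕ : ∀ u v → fromℕ (Graphs.entry G u v) ≡ A u v
      A≡fromℕ u v with does (adj? G u v)
      ... | true  = fromℕ≡ι 1
      ... | false = fromℕ≡ι 0

      D-sym : ∀ u v → D u v ≡ D v u
      D-sym u v with u ≟ v
      ... | yes refl rewrite dec-true (u ≟ u) refl = refl
      ... | no  u≢v  rewrite dec-false (v ≟ u) (≢-sym u≢v) = refl

      Aα-sym : ∀ u v → Aα u v ≈ Aα v u
      Aα-sym u v = reflexive (cong₂ (λ x y → α * x + (𝟙 - α) * y) (D-sym u v)
        (trans (sym (A≡fromℕ u v)) (trans (cong fromℕ (Graphs.entry-sym G u v)) (A≡fromℕ v u))))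

      0≤A : ∀ u v → 𝟘 ≤ A u v
      0≤A u v = subst (𝟘 ≤_) (A≡fromℕ u v) (0≤fromℕ (Graphs.entry G u v))

      0≤D : ∀ u v → 𝟘 ≤ D u v
      0≤D u v with does (u ≟ v)
      ... | true  = 0≤fromℕ (degree G u)
      ... | false = ≤-refl

      Aα-nonneg : ∀ u v → 𝟘 ≤ Aα u v
      Aα-nonneg u v = 0≤+ (0≤* 0≤α (0≤D u v)) (0≤* 0≤1-α (0≤A u v))

      Aα-row : ∀ w u → (Aα · w) u ≈ α * (d u * w u) + (𝟙 - α) * (A · w) u
      Aα-row w u = begin-equality
        sum (λ v → (α * D u v + (𝟙 - α) * A u v) * w v)
          ≈⟨ sum-cong-≋ (λ v → solve 5
               (λ α D β A w → (α :* D :+ β :* A) :* w := α :* (D :* w) :+ β :* (A :* w))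
               ≈-refl α (D u v) (𝟙 - α) (A u v) (w v)) ⟩
        sum (λ v → α * (D u v * w v) + (𝟙 - α) * (A u v * w v))
          ≈⟨ ∑-distrib-+ (λ v → α * (D u v * w v)) (λ v → (𝟙 - α) * (A u v * w v)) ⟩
        sum (λ v → α * (D u v * w v)) + sum (λ v → (𝟙 - α) * (A u v * w v))
          ≈⟨ +-cong (*-distribˡ-sum α λ v → D u v * w v) (*-distribˡ-sum (𝟙 - α) λ v → A u v * w v) ⟨
        α * sum (λ v → D u v * w v) + (𝟙 - α) * (A · w) u
          ≈⟨ +-congʳ (*-congˡ (sum-δ u (d u) w)) ⟩
        α * (d u * w u) + (𝟙 - α) * (A · w) u ∎

      A·1 : ∀ u → sum (A u) ≈ d u
      A·1 u = begin-equality
        sum (A u)                          ≈⟨ sum-cong-≋ (λ v → reflexive (A≡fromℕ u v)) ⟨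
        sum (λ v → fromℕ (Graphs.entry G u v)) ≈⟨ fromℕ-sum (Graphs.entry G u) ⟨
        fromℕ (Counting.sum (Graphs.entry G u))      ≡⟨ cong fromℕ (degree≡sum G u) ⟨
        d u                                ∎

      A·d : ∀ u → (A · d) u ≈ S u
      A·d u = begin-equality
        sum (λ v → A u v * d v)
          ≈⟨ sum-cong-≋ (λ v → ≈-trans (fromℕ-homo-* (Graphs.entry G u v) (degree G v))
                                       (*-congʳ (reflexive (A≡fromℕ u v)))) ⟨
        sum (λ v → fromℕ (Graphs.entry G u v ℕ.* degree G v))
          ≈⟨ fromℕ-sum (λ v → Graphs.entry G u v ℕ.* degree G v) ⟨
        S u ∎

      -- The adjacency matrix sends the constant 1 to `d` and sends `d` to `S`.
      A·affine : ∀ p q u → (A · λ v → d v * p + q) u ≈ S u * p + d u * q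
      A·affine p q u = begin-equality
        sum (λ v → A u v * (d v * p + q))
          ≈⟨ sum-cong-≋ (λ v → solve 4 (λ a d p q → a :* (d :* p :+ q) := (a :* d) :* p :+ a :* q)
               ≈-refl (A u v) (d v) p q) ⟩
        sum (λ v → (A u v * d v) * p + A u v * q)
          ≈⟨ ∑-distrib-+ (λ v → (A u v * d v) * p) (λ v → A u v * q) ⟩
        sum (λ v → (A u v * d v) * p) + sum (λ v → A u v * q)
          ≈⟨ +-cong (*-distribʳ-sum p λ v → A u v * d v) (*-distribʳ-sum q (A u)) ⟨
        (A · d) u * p + sum (A u) * q
          ≈⟨ +-cong (*-congʳ (A·d u)) (*-congʳ (A·1 u)) ⟩
        S u * p + d u * q ∎

      d≤k : ∀ u → d u ≤ k
      d≤k u = fromℕ-mono-≤ (ℕ.+-cancelʳ-≤ 1 _ _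
        (subst (degree G u ℕ.+ 1 ℕ.≤_) (ℕ.+-comm 1 m) (degree-bound G u)))

    -- Upper bound and equality case for trees

    module Extremal (B : Carrier) (quadratic : B * B ≈ α * (N * B) + k * (𝟙 - 𝟚 * α))
      -- `quadratic` admits both roots; `1≤B` and `α≈1⇒k≤B` single out the larger one.
      (1≤B : 𝟙 ≤ B) (α≈1⇒k≤B : α ≈ 𝟙 → k ≤ B) (1≤m : 1 ℕ.≤ m)
      (G : Graph (suc m)) (connected : Connected G) (acyclic : Acyclic G)
      (M : Fin (suc m) → Fin (suc m) → Carrier) (M-sym : ∀ u v → M u v ≈ M v u)
      (M-nonneg : ∀ u v → 𝟘 ≤ M u v)
      (M·affine : ∀ p q u → (M · λ v → d G v * p + q) u ≈
        α * (d G u * (d G u * p + q)) + (𝟙 - α) * (S G u * p + d G u * q))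
      (M·edge : ∀ y → (∀ v → 𝟘 ≤ y v) → ∀ {u v} → Adj G u v → (𝟙 - α) * y v ≤ (M · y) u)
      {μ : Carrier} (v : NonnegSubeigenvector M-sym M-nonneg μ) where

      open NonnegSubeigenvector v

      module Large (k≤B : k ≤ B) where
        private
          -- The constant 1, written with slope `𝟘` so that `M·affine` applies; its image is the
          -- degree, which is at most `k`.
          w : Fin (suc m) → Carrier
          w u = d G u * 𝟘 + 𝟙

          M·w : ∀ u → (M · w) u ≈ d G u
          M·w u = ≈-trans (M·affine 𝟘 𝟙 u)
            (solve 3 (λ α d S → α :* (d :* (d :* nat 0 :+ nat 1)) :+ (nat 1 :- α) :* (S :* nat 0 :+ d :* nat 1) := d)
              ≈-refl α (d G u) (S G u))

          0<w : ∀ u → 0< w u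
          0<w u = 0<-mono (≤-reflexive (solve 1 (λ d → nat 1 := d :* nat 0 :+ nat 1) ≈-refl (d G u))) ι-1≰0

          B*w : ∀ u → B * w u ≈ B
          B*w u = solve 2 (λ B d → B :* (d :* nat 0 :+ nat 1) := B) ≈-refl B (d G u)

          super : ∀ u → (M · w) u ≤ B * w u
          super u = ≤-trans (≤-reflexive (M·w u)) (≤-trans (d≤k G u) (≤-trans k≤B (≤-reflexive (≈-sym (B*w u)))))

        bound : μ ≤ B
        bound = supersolution-bound M-sym M-nonneg w 0<w super v

        -- Without a vertex of full degree the slack `B - d` is positive everywhere, and tightness
        -- would force `y` to vanish.
        full-degree : μ ≈ B → HasFullDegree G
        full-degree μ≈B with hasFullDegree? G
        ... | yes found = found
        ... | no  none  = contradiction (λ u → *-cancelˡ-≤0 (0<B-d u) (begin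
                (B - d G u) * y u              ≈⟨ *-comm _ _ ⟩
                y u * (B - d G u)              ≈⟨ *-congˡ (+-cong (B*w u) (-‿cong (M·w u))) ⟨
                y u * (B * w u - (M · w) u)    ≤⟨ proj₁ (supersolution-tight M-sym M-nonneg w 0<w super v μ≈B u) ⟩
                𝟘                              ∎)) nonzero
          where
          0<B-d : ∀ u → 0< B - d G u
          0<B-d u = ≰⇒0<- λ B≤d → none (u , subst (ℕ._≤ degree G u ℕ.+ 1) (ℕ.+-comm m 1)
            (ℕ.+-monoˡ-≤ 1 (fromℕ-cancel-≤ (≤-trans k≤B B≤d))))

      module Small (k≰B : ¬ (k ≤ B)) where
        private
          -- The weight of a leaf below is `(k - 𝟙) * (𝟙 - α)`. This factor and `𝟙 - α` are positive
          -- because `k ≤ B` fails.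
          0<k-1 : 0< k - 𝟙
          0<k-1 = ≰⇒0<- λ k≤1 → k≰B (≤-trans k≤1 1≤B)

          0<1-α : 0< 𝟙 - α
          0<1-α 1-α≤0 = k≰B (α≈1⇒k≤B (≤-antisym α≤1 (x-y≤0⇒x≤y 1-α≤0)))

          root : B * B - (α * ((𝟙 + k) * B) + k * (𝟙 - 𝟚 * α)) ≈ 𝟘
          root = begin-equality
            B * B - (α * ((𝟙 + k) * B) + k * (𝟙 - 𝟚 * α))
              ≈⟨ +-congˡ (-‿cong (+-congʳ (*-congˡ (*-congʳ N≈1+k)))) ⟨
            B * B - (α * (N * B) + k * (𝟙 - 𝟚 * α))
              ≈⟨ +-congʳ quadratic ⟩
            (α * (N * B) + k * (𝟙 - 𝟚 * α)) - (α * (N * B) + k * (𝟙 - 𝟚 * α))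
              ≈⟨ solve 1 (λ x → x :- x := nat 0) ≈-refl _ ⟩
            𝟘 ∎

          0≤B-1 : 𝟘 ≤ B - 𝟙
          0≤B-1 = x≤y⇒0≤y-x 1≤B

          -- At 1 the quadratic takes the value `- (k - 𝟙) * (𝟙 - α)`, which is not zero, so 1 is
          -- not a root.
          0<B-1 : 0< B - 𝟙
          0<B-1 B-1≤0 = 0<* 0<k-1 0<1-α (≤-reflexive (begin-equality
            (k - 𝟙) * (𝟙 - α)
              ≈⟨ solve 3 (λ α B k → (k :- nat 1) :* (nat 1 :- α) :=
                   (B :- nat 1) :* (B :+ nat 1 :- α :* (nat 1 :+ k))
                   :- (B :* B :- (α :* ((nat 1 :+ k) :* B) :+ k :* (nat 1 :- nat 2 :* α)))) ≈-refl α B k ⟩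
            (B - 𝟙) * (B + 𝟙 - α * (𝟙 + k)) - (B * B - (α * ((𝟙 + k) * B) + k * (𝟙 - 𝟚 * α)))
              ≈⟨ +-cong (*-zeroˡ′ (≤-antisym B-1≤0 0≤B-1)) (-‿cong root) ⟩
            𝟘 - 𝟘 ≈⟨ solve 0 (nat 0 :- nat 0 := nat 0) ≈-refl ⟩
            𝟘 ∎))

          -- Matching the coefficient of `d` in the slack calls for `q = p * (B - α * N)`. With
          -- `p = B - 𝟙` the quadratic turns this into the `q` below, and `d * p + q` becomes
          -- `(d - 𝟙) * p + (k - 𝟙) * (𝟙 - α)`, visibly positive.
          p q : Carrier
          p = B - 𝟙
          q = (k - 𝟙) * (𝟙 - α) - (B - 𝟙)

          -- On a star this is, up to scale, the Perron vector; it is affine in the degree.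
          w : Fin (suc m) → Carrier
          w u = d G u * p + q

          0≤d-1 : ∀ u → 𝟘 ≤ d G u - 𝟙
          0≤d-1 u = x≤y⇒0≤y-x (subst (_≤ d G u) (fromℕ≡ι 1)
            (fromℕ-mono-≤ (connected⇒degree≥1 G connected (proj₂ (Graphs.another-vertex 1≤m u)))))
          0<w : ∀ u → 0< w u
          0<w u = 0<-mono
            (≤-trans (x≤y+x (0≤* (0≤d-1 u) 0≤B-1)) (≤-reflexive
              (solve 4 (λ d α B k → (d :- nat 1) :* (B :- nat 1) :+ (k :- nat 1) :* (nat 1 :- α) :=
                 d :* (B :- nat 1) :+ ((k :- nat 1) :* (nat 1 :- α) :- (B :- nat 1))) ≈-refl (d G u) α B k)))
            (0<* 0<k-1 0<1-α)

          -- As a quadratic in d, the slack from the diagonal vanishes at d = 1 and d = n − 1,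
          -- the degrees in a star.
          slack₁ slack₂ : Fin (suc m) → Carrier
          slack₁ u = α * (p * ((d G u - 𝟙) * (k - d G u)))
          slack₂ u = (𝟙 - α) * (p * (k - S G u))

          slack≈ : ∀ u → B * w u - (M · w) u ≈ slack₁ u + slack₂ u
          slack≈ u = begin-equality
            B * w u - (M · w) u
              ≈⟨ +-congˡ (-‿cong (M·affine p q u)) ⟩
            B * w u - (α * (d G u * w u) + (𝟙 - α) * (S G u * p + d G u * q))
              -- For arbitrary `B` the two sides differ by `d - 𝟙` times the quadratic polynomial,
              -- which vanishes at the root.
              ≈⟨ solve 5 (λ α B k d S →
                   let p = B :- nat 1
                       q = (k :- nat 1) :* (nat 1 :- α) :- p
                       w = d :* p :+ q
                   in B :* w :- (α :* (d :* w) :+ (nat 1 :- α) :* (S :* p :+ d :* q)) :=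
                      (α :* (p :* ((d :- nat 1) :* (k :- d))) :+ (nat 1 :- α) :* (p :* (k :- S)))
                      :+ (d :- nat 1) :* (B :* B :- (α :* ((nat 1 :+ k) :* B) :+ k :* (nat 1 :- nat 2 :* α))))
                   ≈-refl α B k (d G u) (S G u) ⟩
            slack₁ u + slack₂ u + (d G u - 𝟙) * (B * B - (α * ((𝟙 + k) * B) + k * (𝟙 - 𝟚 * α)))
              ≈⟨ +-congˡ (*-zeroʳ′ root) ⟩
            slack₁ u + slack₂ u + 𝟘
              ≈⟨ solve 1 (λ x → x :+ nat 0 := x) ≈-refl _ ⟩
            slack₁ u + slack₂ u ∎

          0≤slack₁ : ∀ u → 𝟘 ≤ slack₁ u
          0≤slack₁ u = 0≤* 0≤α (0≤* 0≤B-1 (0≤* (0≤d-1 u) (x≤y⇒0≤y-x (d≤k G u))))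

          S≤k : ∀ u → S G u ≤ k
          S≤k u = fromℕ-mono-≤ (ℕ.+-cancelʳ-≤ 1 _ _
            (subst (neighbourDegrees G u ℕ.+ 1 ℕ.≤_) (ℕ.+-comm 1 m) (neighbourDegrees-bound G acyclic u)))

          0≤slack₂ : ∀ u → 𝟘 ≤ slack₂ u
          0≤slack₂ u = 0≤* 0≤1-α (0≤* 0≤B-1 (x≤y⇒0≤y-x (S≤k u)))

          super : ∀ u → (M · w) u ≤ B * w u
          super u = 0≤y-x⇒x≤y (≤-trans (0≤+ (0≤slack₁ u) (0≤slack₂ u)) (≤-reflexive (≈-sym (slack≈ u))))

        bound : μ ≤ B
        bound = supersolution-bound M-sym M-nonneg w 0<w super v

        module _ (μ≈B : μ ≈ B) where
          private
            tight = supersolution-tight M-sym M-nonneg w 0<w super v μ≈B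

            -- The positivity argument of Perron and Frobenius: tightness gives
            -- `(M · y) u ≤ μ * y u`, so a zero of `y` at `u` leaves no room for the term of any
            -- neighbour, which has coefficient at least `𝟙 - α`.
            y≤0-spreads : ∀ {u v} → Star (Adj G) u v → y u ≤ 𝟘 → y v ≤ 𝟘
            y≤0-spreads ε y≤0 = y≤0
            y≤0-spreads (_◅_ {u} {v} uv vs) y≤0 = y≤0-spreads vs (*-cancelˡ-≤0 0<1-α (begin
              (𝟙 - α) * y v    ≤⟨ M·edge y nonneg uv ⟩
              (M · y) u        ≤⟨ proj₂ (tight u) ⟩
              μ * y u          ≈⟨ *-zeroʳ′ (≤-antisym y≤0 (nonneg u)) ⟩
              𝟘                ∎))

            0<y : ∀ u → 0< y u
            0<y u y≤0 = nonzero λ v → y≤0-spreads (connected u v) y≤0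

            -- As `y u` is positive, the whole slack at `u` vanishes; both summands are nonnegative,
            -- and the factors `𝟙 - α` and `B - 𝟙` of the second are positive.
            k≤S : ∀ u → k ≤ S G u
            k≤S u = x-y≤0⇒x≤y (*-cancelˡ-≤0 0<B-1 (*-cancelˡ-≤0 0<1-α (begin
              slack₂ u               ≤⟨ x≤y+x (0≤slack₁ u) ⟩
              slack₁ u + slack₂ u    ≈⟨ slack≈ u ⟨
              B * w u - (M · w) u    ≤⟨ *-cancelˡ-≤0 (0<y u) (proj₁ (tight u)) ⟩
              𝟘                      ∎)))

          full-degree : HasFullDegree G
          full-degree = maximal⇒full-degree G acyclic
            (λ u → subst (ℕ._≤ neighbourDegrees G u ℕ.+ 1) (ℕ.+-comm m 1)
              (ℕ.+-monoˡ-≤ 1 (fromℕ-cancel-≤ (k≤S u))))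
            zero

      bound : μ ≤ B
      bound = ≤-stable λ μ≰B → μ≰B (Small.bound λ k≤B → μ≰B (Large.bound k≤B))

      full-degree : μ ≈ B → HasFullDegree G
      full-degree μ≈B = decidable-stable (hasFullDegree? G) λ none →
        none (Small.full-degree (λ k≤B → none (Large.full-degree k≤B μ≈B)) μ≈B)

    -- The star attains the bound

    module _ (B : Carrier) (quadratic : B * B ≈ α * (N * B) + k * (𝟙 - 𝟚 * α)) (1≤m : 1 ℕ.≤ m)
      (G : Graph (suc m)) {c : Fin (suc m)} (star : IsStar G c) where

      private
        -- On these vectors `Aα` acts as the 2 by 2 matrix with rows `α k, (1 - α) k` and
        -- `1 - α, α`. Its trace is `α n` and its determinant `- k (1 - 2 α)`, so `quadratic` is its
        -- characteristic equation.
        radial : Carrier → Carrier → Fin (suc m) → Carrier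
        radial p q v = if does (c ≟ v) then p else q

        radial-leaf : ∀ p q {u} → c ≢ u → radial p q u ≡ q
        radial-leaf p q {u} c≢u rewrite dec-false (c ≟ u) c≢u = refl

        radial-centre : ∀ p q → radial p q c ≡ p
        radial-centre p q rewrite dec-true (c ≟ c) refl = refl

        d-centre : d G c ≈ k
        d-centre = reflexive (cong fromℕ (ℕ.+-cancelʳ-≡ 1 _ _
          (trans (Graphs.star-centre-degree G star) (ℕ.+-comm 1 m))))

        d-leaf : ∀ {u} → c ≢ u → d G u ≈ 𝟙
        d-leaf c≢u = reflexive (trans (cong fromℕ (Graphs.star-leaf-degree G star (≢-sym c≢u))) (fromℕ≡ι 1))

        A·radial-centre : ∀ p q → (A G · radial p q) c ≈ k * q
        A·radial-centre p q = begin-equality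
          sum (λ v → A G c v * radial p q v)    ≈⟨ sum-cong-≋ term ⟩
          sum (λ v → A G c v * q)               ≈⟨ *-distribʳ-sum q (A G c) ⟨
          sum (A G c) * q                       ≈⟨ *-congʳ (≈-trans (A·1 G c) d-centre) ⟩
          k * q                                 ∎
          where
          term : ∀ v → A G c v * radial p q v ≈ A G c v * q
          term v with c ≟ v
          ... | no  _    = ≈-refl
          ... | yes refl = ≈-trans (*-zeroˡ′ Acc≈0) (≈-sym (*-zeroˡ′ Acc≈0))
            where
            Acc≈0 : A G c c ≈ 𝟘
            Acc≈0 = reflexive (trans (sym (A≡fromℕ G c c))
              (trans (cong fromℕ (Graphs.entry-irrefl G c)) (fromℕ≡ι 0)))

        A·radial-leaf : ∀ p q {u} → c ≢ u → (A G · radial p q) u ≈ p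
        A·radial-leaf p q {u} c≢u = begin-equality
          sum (λ v → A G u v * radial p q v)
            ≈⟨ sum-cong-≋ (λ v → *-congʳ {x = radial p q v} (reflexive (row v))) ⟩
          sum (λ v → (if does (c ≟ v) then 𝟙 else 𝟘) * radial p q v)
            ≈⟨ sum-δ c 𝟙 (radial p q) ⟩
          𝟙 * radial p q c
            ≈⟨ *-congˡ (reflexive (radial-centre p q)) ⟩
          𝟙 * p
            ≈⟨ solve 1 (λ p → nat 1 :* p := p) ≈-refl p ⟩
          p ∎
          where
          row : ∀ v → A G u v ≡ (if does (c ≟ v) then 𝟙 else 𝟘)
          row v = trans (sym (A≡fromℕ G u v))
            (trans (cong fromℕ (Graphs.star-leaf-row G star (≢-sym c≢u) v)) indicator)
            where
            indicator : fromℕ (Counting.⟦ c ≟ v ⟧) ≡ (if does (c ≟ v) then 𝟙 else 𝟘)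
            indicator with does (c ≟ v)
            ... | true  = fromℕ≡ι 1
            ... | false = fromℕ≡ι 0

        radial-eigenvalue : ∀ p q → ¬ (p ≈ 𝟘 × q ≈ 𝟘) →
          α * (k * p) + (𝟙 - α) * (k * q) ≈ B * p → α * q + (𝟙 - α) * p ≈ B * q →
          IsEigenvalue (Aα G) B
        radial-eigenvalue p q pq≉0 centre leaf = radial p q , nonzero , λ u → equation u (c ≟ u)
          where
          x = radial p q
          nonzero : ¬ (∀ i → x i ≈ 𝟘)
          nonzero x≈0 = let (u , c≢u) = Graphs.another-vertex 1≤m c in
            pq≉0 ( ≈-trans (reflexive (sym (radial-centre p q))) (x≈0 c)
                 , ≈-trans (reflexive (sym (radial-leaf p q c≢u))) (x≈0 u))
          equation : ∀ u → Dec (c ≡ u) → (Aα G · x) u ≈ B * x u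
          equation u (yes refl) = begin-equality
            (Aα G · x) u                                 ≈⟨ Aα-row G x u ⟩
            α * (d G u * x u) + (𝟙 - α) * (A G · x) u
              ≈⟨ +-cong (*-congˡ (*-cong d-centre (reflexive (radial-centre p q)))) (*-congˡ (A·radial-centre p q)) ⟩
            α * (k * p) + (𝟙 - α) * (k * q)              ≈⟨ centre ⟩
            B * p                                        ≡⟨ cong (B *_) (radial-centre p q) ⟨
            B * x u                                      ∎
          equation u (no c≢u) = begin-equality
            (Aα G · x) u                                 ≈⟨ Aα-row G x u ⟩
            α * (d G u * x u) + (𝟙 - α) * (A G · x) u
              ≈⟨ +-cong (*-congˡ (*-cong (d-leaf c≢u) (reflexive (radial-leaf p q c≢u))))
                        (*-congˡ (A·radial-leaf p q c≢u)) ⟩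
            α * (𝟙 * q) + (𝟙 - α) * p
              ≈⟨ solve 3 (λ α p q → α :* (nat 1 :* q) :+ (nat 1 :- α) :* p := α :* q :+ (nat 1 :- α) :* p) ≈-refl α p q ⟩
            α * q + (𝟙 - α) * p                          ≈⟨ leaf ⟩
            B * q                                        ≡⟨ cong (B *_) (radial-leaf p q c≢u) ⟨
            B * x u                                      ∎

      -- The vector (B - α, 1 - α, …, 1 - α) vanishes exactly when α = B = 1; then Aα is the
      -- degree matrix and the indicator of the leaves is an eigenvector.
      star-eigenvalue : ¬ ¬ IsEigenvalue (Aα G) B
      star-eigenvalue no-eigenvector = no-eigenvector
        (radial-eigenvalue (B - α) (𝟙 - α) (no-eigenvector ∘ degenerate) centre
          (solve 2 (λ α B → α :* (nat 1 :- α) :+ (nat 1 :- α) :* (B :- α) := B :* (nat 1 :- α)) ≈-refl α B))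
        where
        centre : α * (k * (B - α)) + (𝟙 - α) * (k * (𝟙 - α)) ≈ B * (B - α)
        centre = begin-equality
          α * (k * (B - α)) + (𝟙 - α) * (k * (𝟙 - α))
            ≈⟨ solve 3 (λ α k B → α :* (k :* (B :- α)) :+ (nat 1 :- α) :* (k :* (nat 1 :- α)) :=
                 (α :* ((nat 1 :+ k) :* B) :+ k :* (nat 1 :- nat 2 :* α)) :- B :* α) ≈-refl α k B ⟩
          (α * ((𝟙 + k) * B) + k * (𝟙 - 𝟚 * α)) - B * α
            ≈⟨ +-congʳ (≈-trans quadratic (+-congʳ (*-congˡ (*-congʳ N≈1+k)))) ⟨
          B * B - B * α
            ≈⟨ solve 2 (λ α B → B :* B :- B :* α := B :* (B :- α)) ≈-refl α B ⟩
          B * (B - α) ∎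
        degenerate : B - α ≈ 𝟘 × 𝟙 - α ≈ 𝟘 → IsEigenvalue (Aα G) B
        degenerate (B-α≈0 , 1-α≈0) = radial-eigenvalue 𝟘 𝟙 (λ (_ , 1≈0) → ι-1≰0 (≤-reflexive 1≈0))
          (begin-equality
            α * (k * 𝟘) + (𝟙 - α) * (k * 𝟙)    ≈⟨ +-congˡ (*-zeroˡ′ 1-α≈0) ⟩
            α * (k * 𝟘) + 𝟘                    ≈⟨ solve 3 (λ α k B → α :* (k :* nat 0) :+ nat 0 := B :* nat 0) ≈-refl α k B ⟩
            B * 𝟘                              ∎)
          (begin-equality
            α * 𝟙 + (𝟙 - α) * 𝟘    ≈⟨ solve 2 (λ α B → α :* nat 1 :+ (nat 1 :- α) :* nat 0 := B :* nat 1 :- (B :- α)) ≈-refl α B ⟩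
            B * 𝟙 - (B - α)        ≈⟨ +-congˡ (-‿cong B-α≈0) ⟩
            B * 𝟙 - 𝟘              ≈⟨ solve 1 (λ x → x :- nat 0 := x) ≈-refl (B * 𝟙) ⟩
            B * 𝟙                  ∎)

    -- The larger root, and the theorem over an ordered algebra

    module _ (1≤m : 1 ℕ.≤ m) (s : Carrier) (0≤s : 𝟘 ≤ s)
      (s²≈ : s * s ≈ (α * α) * (N * N) + 𝟜 * k * (𝟙 - 𝟚 * α)) where

      B : Carrier
      B = (α * N + s) * ½

      private
        s²≈′ : s * s ≈ (α * α) * ((𝟙 + k) * (𝟙 + k)) + 𝟜 * k * (𝟙 - 𝟚 * α)
        s²≈′ = ≈-trans s²≈ (+-congʳ (*-congˡ (*-cong N≈1+k N≈1+k)))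

        B≈ : B ≈ (α * (𝟙 + k) + s) * ½
        B≈ = *-congʳ (+-congʳ (*-congˡ N≈1+k))

        0≤k-1 : 𝟘 ≤ k - 𝟙
        0≤k-1 = x≤y⇒0≤y-x (subst (_≤ k) (fromℕ≡ι 1) (fromℕ-mono-≤ 1≤m))

        ≤-half : ∀ {x y} → x + x - y ≤ s → x ≤ (y + s) * ½
        ≤-half {x} {y} h = ≤-trans
          (≤-reflexive (solve 2 (λ x y → x := con ℚ.½ :* (y :+ (x :+ x :- y))) ≈-refl x y))
          (≤-trans (*-monoˡ-≤ (ι-mono-≤ (ℚ.<⇒≤ (ℚ.positive⁻¹ ℚ.½))) (+-mono-≤ ≤-refl h)) (≤-reflexive (*-comm _ _)))

        disc : Carrier
        disc = (α * α) * (N * N) + 𝟜 * k * (𝟙 - 𝟚 * α)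

        -- Completing the square: the two sides differ by a quarter of `s * s - disc`.
        quadratic : B * B ≈ α * (N * B) + k * (𝟙 - 𝟚 * α)
        quadratic = begin-equality
          B * B
            ≈⟨ solve 4 (λ α N k s →
                 let B = (α :* N :+ s) :* con ℚ.½
                     disc = (α :* α) :* (N :* N) :+ nat 4 :* k :* (nat 1 :- nat 2 :* α)
                 in B :* B := (α :* (N :* B) :+ k :* (nat 1 :- nat 2 :* α))
                      :+ con (ℚ.½ ℚ.* ℚ.½) :* (s :* s :- disc))
                 ≈-refl α N k s ⟩
          (α * (N * B) + k * (𝟙 - 𝟚 * α)) + ι (ℚ.½ ℚ.* ℚ.½) * (s * s - disc)
            ≈⟨ +-congˡ (*-congˡ (+-congʳ s²≈)) ⟩
          (α * (N * B) + k * (𝟙 - 𝟚 * α)) + ι (ℚ.½ ℚ.* ℚ.½) * (disc - disc)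
            ≈⟨ solve 3 (λ x q y → x :+ q :* (y :- y) := x) ≈-refl _ _ disc ⟩
          α * (N * B) + k * (𝟙 - 𝟚 * α) ∎

        -- Amounts to `2 - α n ≤ s`, whose left side may be negative; the square of `s` exceeds that
        -- of the left side by `4 (k - 1) (1 - α)`.
        1≤B : 𝟙 ≤ B
        1≤B = ≤-trans (≤-half (square-cancel-≤ 0≤s (0≤y-x⇒x≤y (begin
          𝟘 ≤⟨ 0≤* (ι-mono-≤ (ℚ.<⇒≤ (ℚ.positive⁻¹ (+ 4 ℚ./ 1)))) (0≤* 0≤k-1 0≤1-α) ⟩
          𝟜 * ((k - 𝟙) * (𝟙 - α))
            ≈⟨ solve 2 (λ α k → let t = nat 1 :+ nat 1 :- α :* (nat 1 :+ k) in
                 nat 4 :* ((k :- nat 1) :* (nat 1 :- α)) :=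
                 ((α :* α) :* ((nat 1 :+ k) :* (nat 1 :+ k)) :+ nat 4 :* k :* (nat 1 :- nat 2 :* α)) :- t :* t)
                 ≈-refl α k ⟩
          (α * α) * ((𝟙 + k) * (𝟙 + k)) + 𝟜 * k * (𝟙 - 𝟚 * α) - (𝟙 + 𝟙 - α * (𝟙 + k)) * (𝟙 + 𝟙 - α * (𝟙 + k))
            ≈⟨ +-congʳ s²≈′ ⟨
          s * s - (𝟙 + 𝟙 - α * (𝟙 + k)) * (𝟙 + 𝟙 - α * (𝟙 + k)) ∎)))) (≤-reflexive (≈-sym B≈))

        -- For `α = 1` the discriminant is `n² - 4 k = (k - 1)²`, so `s` is at least `k - 1` and `B`
        -- at least `(n + k - 1) / 2 = k`.
        α≈1⇒k≤B : α ≈ 𝟙 → k ≤ B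
        α≈1⇒k≤B α≈1 = ≤-trans (≤-half (begin
          k + k - α * (𝟙 + k)        ≈⟨ +-congˡ (-‿cong (*-congʳ α≈1)) ⟩
          k + k - 𝟙 * (𝟙 + k)        ≤⟨ square-cancel-≤ 0≤s (≤-reflexive (begin-equality
            (k + k - 𝟙 * (𝟙 + k)) * (k + k - 𝟙 * (𝟙 + k))
              ≈⟨ solve 1 (λ k → let t = k :+ k :- nat 1 :* (nat 1 :+ k) in t :* t :=
                   (nat 1 :* nat 1) :* ((nat 1 :+ k) :* (nat 1 :+ k)) :+ nat 4 :* k :* (nat 1 :- nat 2 :* nat 1)) ≈-refl k ⟩
            (𝟙 * 𝟙) * ((𝟙 + k) * (𝟙 + k)) + 𝟜 * k * (𝟙 - 𝟚 * 𝟙)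
              ≈⟨ +-cong (*-congʳ (*-cong α≈1 α≈1)) (*-congˡ (+-congˡ (-‿cong (*-congˡ α≈1)))) ⟨
            (α * α) * ((𝟙 + k) * (𝟙 + k)) + 𝟜 * k * (𝟙 - 𝟚 * α)
              ≈⟨ s²≈′ ⟨
            s * s ∎)) ⟩
          s ∎)) (≤-reflexive (≈-sym B≈))

      tree-bound : (G : Graph (suc m)) → Connected G → Acyclic G →
        ∀ {M} → (∀ u v → M u v ≈ Aα G u v) →
        ∀ ρ → IsEigenvalue M ρ → (∀ μ → IsEigenvalue M μ → μ ≤ ρ) →
        (ρ ≤ B) × (ρ ≈ B ⇔ G ≅ K 1 m)
      tree-bound G connected acyclic {M} M≈Aα ρ eigenM largest = ρ≤B , mk⇔
          (λ ρ≈B →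
            let (c , full) = decidable-stable (hasFullDegree? G) λ none →
                  subeigenvector (Aα-sym G) (Aα-nonneg G) eigen λ v → none (Extremal′.full-degree v ρ≈B)
            in star⇒≅K G (full-degree⇒star G acyclic full))
          -- On a star `B` is itself an eigenvalue, hence at most the largest one.
          (λ iso → let (c , star) = ≅K⇒star G iso in
            ≤-antisym ρ≤B (≤-stable λ B≰ρ → star-eigenvalue B quadratic 1≤m G star λ e →
              B≰ρ (largest B (IsEigenvalue-cong {M = Aα G} {M} (λ u v → ≈-sym (M≈Aα u v)) e))))
        where
        eigen : IsEigenvalue (Aα G) ρ
        eigen = IsEigenvalue-cong {M = M} {Aα G} M≈Aα eigenM
        Aα·affine : ∀ p q u → (Aα G · λ v → d G v * p + q) u ≈
          α * (d G u * (d G u * p + q)) + (𝟙 - α) * (S G u * p + d G u * q)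
        Aα·affine p q u = ≈-trans (Aα-row G (λ v → d G v * p + q) u) (+-congˡ (*-congˡ (A·affine G p q u)))
        Aα·edge : ∀ y → (∀ v → 𝟘 ≤ y v) → ∀ {u v} → Adj G u v → (𝟙 - α) * y v ≤ (Aα G · y) u
        Aα·edge y 0≤y {u} {v} uv = begin
          (𝟙 - α) * y v
            ≤⟨ *-monoˡ-≤ 0≤1-α (begin
                 y v            ≈⟨ solve 1 (λ y → y := nat 1 :* y) ≈-refl (y v) ⟩
                 𝟙 * y v        ≡⟨ cong (_* y v) (cong (λ b → if b then 𝟙 else 𝟘) (dec-true (adj? G u v) uv)) ⟨
                 A G u v * y v  ≤⟨ term≤sum (λ v → 0≤* (0≤A G u v) (0≤y v)) v ⟩
                 (A G · y) u    ∎) ⟩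
          (𝟙 - α) * (A G · y) u
            ≤⟨ x≤y+x (0≤* 0≤α (0≤* (0≤fromℕ (degree G u)) (0≤y u))) ⟩
          α * (d G u * y u) + (𝟙 - α) * (A G · y) u
            ≈⟨ Aα-row G y u ⟨
          (Aα G · y) u ∎
        module Extremal′ {μ} (v : NonnegSubeigenvector (Aα-sym G) (Aα-nonneg G) μ) =
          Extremal B quadratic 1≤B α≈1⇒k≤B 1≤m G connected acyclic (Aα G) (Aα-sym G) (Aα-nonneg G)
            Aα·affine Aα·edge v
        ρ≤B : ρ ≤ B
        ρ≤B = ≤-stable λ ρ≰B → subeigenvector (Aα-sym G) (Aα-nonneg G) eigen λ v → ρ≰B (Extremal′.bound v)

-- Specialisation to the Cauchy reals

ℝ-classicalOrderedAlgebra : ClassicalOrderedAlgebra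
ℝ-classicalOrderedAlgebra = record
  { commutativeRing = +-*-commutativeRing
  ; algebra         = fromℚ-homo
  ; _≤_             = Defs._≤_
  ; ≤-reflexive     = λ {x y} → ≈⇒≤ {x} {y}
  ; ≤-trans         = λ {x y z} → ≤-trans {x} {y} {z}
  ; ≤-antisym       = λ {x y} → ≤-antisym {x} {y}
  ; +-mono-≤        = λ {x y u v} → +-mono-≤ {x} {y} {u} {v}
  ; ≤-stable        = λ {x y} → ≤-stable {x} {y}
  ; ≰⇒≥             = λ {x y} → ≰⇒≥ {x} {y}
  ; *-cancelˡ-≤0    = λ {x y} → *-cancelˡ-≤0 {x} {y}
  ; ι-mono-≤        = fromℚ-mono-≤
  ; ι-1≰0           = 1≰0
  ; fromℕ           = Defs.fromℕ
  ; fromℕ≡ι         = λ _ → refl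
  }
  where open RealNumbers

open import Defs

-- Stated for a variable matrix: for a concrete one the conversion check would compare
-- the Cauchy moduli of all entries.
module _ {n} {M : Matrix n} {μ : ℝ} where
  open Theory ℝ-classicalOrderedAlgebra renaming (IsEigenvalue to IsEigenvalue′)

  toTheory : IsEigenvalue M μ → IsEigenvalue′ M μ
  toTheory eigen = eigen

  fromTheory : IsEigenvalue′ M μ → IsEigenvalue M μ
  fromTheory eigen = eigen

theorem2 : (n : ℕ) → n ≥ 2 → (α : ℝ) → 0ℝ ≤ α → α ≤ 1ℝ →
    (T : Graph n) → IsTree T →
    (ρ : ℝ) → IsLargestEigenvalue (A[ α ] T) ρ →
    (s : ℝ) → IsSqrt s (α ² * fromℕ n ² + fromℕ 4 * fromℕ (n ∸ 1) * (1ℝ - fromℕ 2 * α)) →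
    (ρ ≤ (α * fromℕ n + s) * ½) × (ρ ≈ (α * fromℕ n + s) * ½ ⇔ T ≅ K 1 (n ∸ 1))
theorem2 (suc m) (s≤s 1≤m) α 0≤α α≤1 T (connected , acyclic) ρ (eigen , largest) s (0≤s , s²≈) =
  Theory.tree-bound ℝ-classicalOrderedAlgebra α 0≤α α≤1 1≤m s 0≤s s²≈ T connected acyclic
    {A[ α ] T} (λ u v → RealNumbers.≈-refl {A[ α ] T u v}) ρ
    (toTheory {M = A[ α ] T} {ρ} eigen) (λ μ e → largest μ (fromTheory {M = A[ α ] T} {μ} e))
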